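{- Let $G$ be a connected simple graph with biconnected decomposition with oddments $G_0,B_1,\dots,B_{r'}$. Then the Ehrhart series of $G$ factors as $H_G(t)=H_{G_0}(t)\prod_{i=1}^{r'}H_{B_i}(t)$.
   Context: For a graph $H$ with vertices $v_1,\dots,v_n$, its edge polytope is $\mathcal{P}_H=\mathrm{conv}\{\mathbf{e}_i+\mathbf{e}_j:\{v_i,v_j\}\text{ an edge}\}\subset\mathbb{R}^n$ and its Ehrhart series is $H_H(t)=\sum_{m\ge0}|m\mathcal{P}_H\cap\mathbb{Z}^n|t^m$ (with the $m=0$ term equal to $1$). Biconnected decomposition with oddments: let $B_1,\dots,B_r$ be the biconnected components (blocks) of $G$; let $G_0$ be the minimum connected subgraph of $G$ containing all blocks that contain an odd cycle; after renumbering, $B_1,\dots,B_{r'}$ are the blocks not contained in $G_0$, so that $G$ decomposes as $G_0,B_1,\dots,B_{r'}$. (If $G$ has no odd cycle, $G_0$ is empty and $H_{G_0}(t)$ is read as $1$.) -}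

module Defs where

open import Data.Nat as ℕ using (ℕ; zero; suc; _<_; _∸_; _%_; s≤s)
import Data.Nat.Properties as ℕP
open import Data.Integer as ℤ using (ℤ; +_)
open import Data.Rational as ℚ using (ℚ; 0ℚ; _/_)
open import Data.Fin using (Fin; toℕ; fromℕ<)
import Data.Fin as Fin
import Data.Bool
open import Data.Vec using (Vec; lookup)
open import Data.Bool using (Bool; true; false; _∨_)
open import Data.Product using (Σ; ∃; _×_; _,_)
open import Data.Sum using (_⊎_)
open import Relation.Binary.PropositionalEquality using (_≡_; _≢_)
open import Relation.Nullary using (¬_; yes; no)
open import Function.Definitions using (Injective)

sumFin : ∀ {n} → (Fin n → ℚ) → ℚ
sumFin {zero}  f = 0ℚ
sumFin {suc n} f = f Fin.zero ℚ.+ sumFin (λ i → f (Fin.suc i))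

sumℕ≤ : ℕ → (ℕ → ℕ) → ℕ
sumℕ≤ zero    f = f 0
sumℕ≤ (suc m) f = sumℕ≤ m f ℕ.+ f (suc m)

-- An edge set / adjacency relation on Fin n (only unordered pairs matter;
-- all edge sets used below are symmetric and irreflexive).
EdgeSet : ℕ → Set
EdgeSet n = Fin n → Fin n → Bool

record SimpleGraph (n : ℕ) : Set where
  field
    adj     : EdgeSet n
    symm    : ∀ i j → adj i j ≡ adj j i
    irrefl  : ∀ i → adj i i ≡ false
open SimpleGraph public

data Walk {n} (E : EdgeSet n) : Fin n → Fin n → Set where
  here : ∀ {u} → Walk E u u
  step : ∀ {u v w} → E u v ≡ true → Walk E v w → Walk E u w

Touches : ∀ {n} → EdgeSet n → Fin n → Set
Touches E u = ∃ λ w → E u w ≡ true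

-- the subgraph formed by the edges E (and their end vertices) is connected
-- (the empty subgraph counts as connected)
ConnectedE : ∀ {n} → EdgeSet n → Set
ConnectedE E = ∀ u v → Touches E u → Touches E v → Walk E u v

Connected : ∀ {n} → SimpleGraph n → Set
Connected G = ∀ u v → Walk (adj G) u v

next : ∀ {m} → Fin (suc m) → Fin (suc m)
next {m} i with toℕ i ℕP.<? m
... | yes p = fromℕ< (s≤s p)
... | no _  = Fin.zero

record Cycle {n} (E : EdgeSet n) : Set where
  field
    len₋₃  : ℕ
    vert   : Fin (3 ℕ.+ len₋₃) → Fin n
    inj    : Injective _≡_ _≡_ vert
    edges  : ∀ t → E (vert t) (vert (next t)) ≡ true
open Cycle public

cycleLength : ∀ {n} {E : EdgeSet n} → Cycle E → ℕ
cycleLength C = 3 ℕ.+ len₋₃ C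

OnCycle : ∀ {n} {E : EdgeSet n} → Cycle E → Fin n → Fin n → Set
OnCycle C a b = ∃ λ t → (vert C t ≡ a × vert C (next t) ≡ b)
                       ⊎ (vert C t ≡ b × vert C (next t) ≡ a)

-- Biconnected components (blocks), as classes of edges:
-- two edges are in the same block iff they are equal or lie on a common cycle.

SameBlock : ∀ {n} → SimpleGraph n → (a b c d : Fin n) → Set
SameBlock G a b c d =
  ((a ≡ c × b ≡ d) ⊎ (a ≡ d × b ≡ c))
  ⊎ (Σ (Cycle (adj G)) λ C → OnCycle C a b × OnCycle C c d)

_⊆E_ : ∀ {n} → EdgeSet n → EdgeSet n → Set
E ⊆E F = ∀ i j → E i j ≡ true → F i j ≡ true

record IsBlock {n} (G : SimpleGraph n) (B : EdgeSet n) : Set where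
  field
    sub      : B ⊆E adj G
    symmB    : ∀ i j → B i j ≡ B j i
    nonempty : ∃ λ a → ∃ λ b → B a b ≡ true
    closed   : ∀ a b c d → B a b ≡ true → adj G c d ≡ true →
               (B c d ≡ true → SameBlock G a b c d) × (SameBlock G a b c d → B c d ≡ true)

HasOddCycle : ∀ {n} → EdgeSet n → Set
HasOddCycle B = Σ (Cycle B) λ C → cycleLength C % 2 ≡ 1

record BlockList {n} (G : SimpleGraph n) (r : ℕ) (B : Fin r → EdgeSet n) : Set where
  field
    isBlock  : ∀ k → IsBlock G (B k)
    disjoint : ∀ k l → k ≢ l → ∀ a b → B k a b ≡ true → B l a b ≡ false
    covers   : ∀ a b → adj G a b ≡ true → ∃ λ k → B k a b ≡ true

unionE : ∀ {n r} → (Fin r → EdgeSet n) → (Fin r → Bool) → EdgeSet n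
unionE {r = zero}  B S i j = false
unionE {r = suc r} B S i j =
  (S Fin.zero Data.Bool.∧ B Fin.zero i j) ∨ unionE (λ k → B (Fin.suc k)) (λ k → S (Fin.suc k)) i j

Admissible : ∀ {n r} → (Fin r → EdgeSet n) → (Fin r → Bool) → Set
Admissible B T = (∀ k → HasOddCycle (B k) → T k ≡ true) × ConnectedE (unionE B T)

-- S selects G₀: the minimum connected union of blocks containing all blocks
-- with an odd cycle (S is empty when G has no odd cycle)
IsOddmentCore : ∀ {n r} → (Fin r → EdgeSet n) → (Fin r → Bool) → Set
IsOddmentCore B S =
  Admissible B S × (∀ T → Admissible B T → ∀ k → S k ≡ true → T k ≡ true)

-- x ∈ m·P_E : x = Σ_{edges {i,j} of E} λ_ij (e_i + e_j), λ ≥ 0, Σ λ = m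
-- (λ indexed by ordered pairs i < j; rational coefficients)
InDilate : ∀ {n} → EdgeSet n → ℕ → Vec ℤ n → Set
InDilate {n} E m x =
  Σ (Fin n → Fin n → ℚ) λ lam →
    (∀ i j → 0ℚ ℚ.≤ lam i j)
  × (∀ i j → lam i j ≢ 0ℚ → (toℕ i < toℕ j) × E i j ≡ true)
  × (sumFin (λ i → sumFin (λ j → lam i j)) ≡ (+ m) / 1)
  × (∀ v → (lookup x v) / 1 ≡ sumFin (λ u → lam v u ℚ.+ lam u v))

HasCard : ∀ {n} → (Vec ℤ n → Set) → ℕ → Set
HasCard {n} P c = Σ (Fin c → Vec ℤ n) λ f →
  Injective _≡_ _≡_ f × (∀ k → P (f k)) × (∀ x → P x → ∃ λ k → f k ≡ x)

-- h is the coefficient sequence of the Ehrhart series of P_E: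
-- h m = |m·P_E ∩ ℤⁿ|  (for m = 0 this is 1, also for E empty)
IsEhrhart : ∀ {n} → EdgeSet n → (ℕ → ℕ) → Set
IsEhrhart E h = ∀ m → HasCard (InDilate E m) (h m)

Series : Set
Series = ℕ → ℕ

oneS : Series
oneS zero    = 1
oneS (suc _) = 0

_*S_ : Series → Series → Series
(f *S g) m = sumℕ≤ m (λ k → f k ℕ.* g (m ∸ k))

prodNotIn : ∀ {r} → (Fin r → Bool) → (Fin r → Series) → Series
prodNotIn {zero}  S h = oneS
prodNotIn {suc r} S h with S Fin.zero
... | true  = prodNotIn (λ k → S (Fin.suc k)) (λ k → h (Fin.suc k))
... | false = h Fin.zero *S prodNotIn (λ k → S (Fin.suc k)) (λ k → h (Fin.suc k))

{-# OPTIONS --safe #-}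

-- Only this is used about G₀: it is connected and contains every block with an
-- odd cycle. Starting from G₀, blocks are attached one at a time, each block B
-- meeting the connected union T built so far in a single vertex p; two common
-- vertices would give a cycle running through two different blocks. As B has no
-- odd cycle, it is bipartite. Write a lattice point of m P_{T ∪ B} as x + y with
-- x and y rational points of dilates of P_T and P_B. Away from p, one of x and y
-- vanishes, so y is integral there. Both colour classes of B have y-sum equal to
-- the dilation factor of y; the class avoiding p shows that the factor is an
-- integer, and then the other class shows that y(p) is one. The same argument
-- with {0} in place of ℤ shows that x and y are unique, so Ehrhart series
-- multiply.
module Submission where

open import Defs
open import Data.Nat as ℕ using (ℕ; zero; suc; _∸_; _≤_; z≤n; s≤s; _%_)
import Data.Nat.Properties as ℕP
open import Data.Nat.Tactic.RingSolver using (solve-∀)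
open import Data.Integer as ℤ using (ℤ; +_)
import Data.Integer.Properties as ℤP
open import Data.Rational as ℚ using (ℚ; 0ℚ; _/_)
import Data.Rational.Properties as ℚP
open import Data.Rational.Unnormalised as ℚᵘ using (mkℚᵘ; *≡*; *≤*)
import Data.Rational.Unnormalised.Properties as ℚᵘP
open import Data.Fin as Fin using (Fin; zero; suc; toℕ; fromℕ<; inject₁)
import Data.Fin.Properties as FinP
open import Data.Fin.Induction using (<-weakInduction)
open import Data.Bool using (Bool; true; false; not; if_then_else_; _∧_; _∨_; _xor_)
import Data.Bool.Properties as BoolP
open import Data.List using (List; []; _∷_; _++_; length)
import Data.List.Properties as ListP
open import Data.List.Relation.Unary.All as All using (All; []; _∷_)
import Data.List.Relation.Unary.All.Properties as AllP
open import Data.List.Relation.Unary.AllPairs using ([]; _∷_)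
import Data.List.Relation.Unary.AllPairs.Properties as AllPairsP
open import Data.List.Relation.Unary.Unique.Propositional using (Unique)
open import Data.Vec using (Vec; lookup; tabulate; zipWith)
import Data.Vec.Properties as VecP
open import Data.Vec.Functional using (updateAt)
open import Data.Vec.Functional.Properties using (updateAt-updates; updateAt-minimal)
open import Data.Product using (Σ; ∃; ∃₂; _×_; _,_; proj₁; proj₂)
open import Data.Sum using (_⊎_; inj₁; inj₂; [_,_]′)
open import Data.Empty using (⊥; ⊥-elim)
open import Relation.Binary.PropositionalEquality
open import Relation.Nullary using (¬_; yes; no; Dec)
open import Relation.Unary using (Decidable)
open import Function using (_∘_; _⇔_; mk⇔; Equivalence)
open import Function.Definitions using (Injective)
open import Algebra.Bundles using (AbelianGroup; CommutativeMonoid)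
import Algebra.Properties.Group
open import Algebra.Properties.CommutativeMonoid.Sum ℚP.+-0-commutativeMonoid
  using (sum; ∑-distrib-+; ∑-comm)
open import Algebra.Properties.CommutativeSemigroup
  (CommutativeMonoid.commutativeSemigroup ℚP.+-0-commutativeMonoid) using (interchange)
open import Algebra.Properties.AbelianGroup ℚP.+-0-abelianGroup using (xyx⁻¹≈y; ⁻¹-∙-comm)
open import Algebra.Properties.Group ℚP.+-0-group
  using (//-rightDividesʳ; x∙y⁻¹≈ε⇒x≈y; x≈y⇒x∙y⁻¹≈ε)
module ℤG = Algebra.Properties.Group (AbelianGroup.group ℤP.+-0-abelianGroup)

-- Power series

sumℕ≤-cong : ∀ m {f g : Series} → (∀ k → k ≤ m → f k ≡ g k) → sumℕ≤ m f ≡ sumℕ≤ m g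
sumℕ≤-cong zero    f≡g = f≡g 0 z≤n
sumℕ≤-cong (suc m) f≡g =
  cong₂ ℕ._+_ (sumℕ≤-cong m λ k k≤m → f≡g k (ℕP.m≤n⇒m≤1+n k≤m)) (f≡g (suc m) ℕP.≤-refl)

sumℕ≤-head : ∀ m (f : Series) → sumℕ≤ (suc m) f ≡ f 0 ℕ.+ sumℕ≤ m (f ∘ suc)
sumℕ≤-head zero    f = refl
sumℕ≤-head (suc m) f =
  trans (cong (ℕ._+ f (suc (suc m))) (sumℕ≤-head m f)) (ℕP.+-assoc (f 0) _ _)

sumℕ≤-linear : ∀ m a (f g : Series) →
  sumℕ≤ m (λ k → a ℕ.* f k ℕ.+ g k) ≡ a ℕ.* sumℕ≤ m f ℕ.+ sumℕ≤ m g
sumℕ≤-linear zero    a f g = refl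
sumℕ≤-linear (suc m) a f g = trans
  (cong (ℕ._+ (a ℕ.* f (suc m) ℕ.+ g (suc m))) (sumℕ≤-linear m a f g))
  (regroup a (sumℕ≤ m f) (sumℕ≤ m g) (f (suc m)) (g (suc m)))
  where
  regroup : ∀ a F G x y → a ℕ.* F ℕ.+ G ℕ.+ (a ℕ.* x ℕ.+ y) ≡ a ℕ.* (F ℕ.+ x) ℕ.+ (G ℕ.+ y)
  regroup = solve-∀

*S-cong : ∀ {f f′ g g′ : Series} → f ≗ f′ → g ≗ g′ → (f *S g) ≗ (f′ *S g′)
*S-cong f≗f′ g≗g′ m = sumℕ≤-cong m λ k _ → cong₂ ℕ._*_ (f≗f′ k) (g≗g′ (m ∸ k))

*S-last : ∀ (f g : Series) m → (f *S g) (suc m) ≡ (f *S (g ∘ suc)) m ℕ.+ f (suc m) ℕ.* g 0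
*S-last f g m = cong₂ ℕ._+_
  (sumℕ≤-cong m λ k k≤m → cong (λ j → f k ℕ.* g j) (ℕP.+-∸-assoc 1 k≤m))
  (cong (λ j → f (suc m) ℕ.* g j) (ℕP.n∸n≡0 m))

-- The product `f 0 ℕ.* g (suc m)` is the first term of one convolution and the last term of the
-- other; removing it leaves the same claim for `f ∘ suc` and `g`.
*S-comm : ∀ (f g : Series) → (f *S g) ≗ (g *S f)
*S-comm f g zero    = ℕP.*-comm (f 0) (g 0)
*S-comm f g (suc m) = begin
  (f *S g) (suc m)                              ≡⟨ sumℕ≤-head m _ ⟩
  f 0 ℕ.* g (suc m) ℕ.+ ((f ∘ suc) *S g) m      ≡⟨ cong₂ ℕ._+_ (ℕP.*-comm (f 0) _) (*S-comm (f ∘ suc) g m) ⟩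
  g (suc m) ℕ.* f 0 ℕ.+ (g *S (f ∘ suc)) m      ≡⟨ ℕP.+-comm (g (suc m) ℕ.* f 0) _ ⟩
  (g *S (f ∘ suc)) m ℕ.+ g (suc m) ℕ.* f 0      ≡⟨ *S-last g f m ⟨
  (g *S f) (suc m)                              ∎
  where open ≡-Reasoning

*S-linearˡ : ∀ a (f g h : Series) m →
  ((λ k → a ℕ.* f k ℕ.+ g k) *S h) m ≡ a ℕ.* (f *S h) m ℕ.+ (g *S h) m
*S-linearˡ a f g h m = trans
  (sumℕ≤-cong m λ k _ → expand a (f k) (g k) (h (m ∸ k)))
  (sumℕ≤-linear m a (λ k → f k ℕ.* h (m ∸ k)) (λ k → g k ℕ.* h (m ∸ k)))
  where
  expand : ∀ a x y z → (a ℕ.* x ℕ.+ y) ℕ.* z ≡ a ℕ.* (x ℕ.* z) ℕ.+ y ℕ.* z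
  expand = solve-∀

-- Induction on the coefficient with `f` replaced by its shift. The shift of `f *S g` is `f 0` times
-- the shift of `g` plus `(f ∘ suc) *S g`, and linearity separates the two.
*S-assoc : ∀ (f g h : Series) → ((f *S g) *S h) ≗ (f *S (g *S h))
*S-assoc f g h zero    = ℕP.*-assoc (f 0) (g 0) (h 0)
*S-assoc f g h (suc m) = begin
  ((f *S g) *S h) (suc m)
    ≡⟨ sumℕ≤-head m _ ⟩
  f 0 ℕ.* g 0 ℕ.* h (suc m) ℕ.+ (((f *S g) ∘ suc) *S h) m
    ≡⟨ cong (f 0 ℕ.* g 0 ℕ.* h (suc m) ℕ.+_) (*S-cong {g = h} (λ k → sumℕ≤-head k _) (λ _ → refl) m) ⟩
  f 0 ℕ.* g 0 ℕ.* h (suc m) ℕ.+ ((λ k → f 0 ℕ.* g (suc k) ℕ.+ ((f ∘ suc) *S g) k) *S h) m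
    ≡⟨ cong (f 0 ℕ.* g 0 ℕ.* h (suc m) ℕ.+_) (*S-linearˡ (f 0) (g ∘ suc) ((f ∘ suc) *S g) h m) ⟩
  f 0 ℕ.* g 0 ℕ.* h (suc m) ℕ.+ (f 0 ℕ.* ((g ∘ suc) *S h) m ℕ.+ (((f ∘ suc) *S g) *S h) m)
    ≡⟨ regroup (f 0) (g 0) (h (suc m)) (((g ∘ suc) *S h) m) _ ⟩
  f 0 ℕ.* (g 0 ℕ.* h (suc m) ℕ.+ ((g ∘ suc) *S h) m) ℕ.+ (((f ∘ suc) *S g) *S h) m
    ≡⟨ cong₂ (λ x y → f 0 ℕ.* x ℕ.+ y) (sym (sumℕ≤-head m _)) (*S-assoc (f ∘ suc) g h m) ⟩
  f 0 ℕ.* (g *S h) (suc m) ℕ.+ ((f ∘ suc) *S (g *S h)) m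
    ≡⟨ sumℕ≤-head m _ ⟨
  (f *S (g *S h)) (suc m) ∎
  where
  open ≡-Reasoning
  regroup : ∀ a b c d e → a ℕ.* b ℕ.* c ℕ.+ (a ℕ.* d ℕ.+ e) ≡ a ℕ.* (b ℕ.* c ℕ.+ d) ℕ.+ e
  regroup = solve-∀

*S-leftSwap : ∀ (f g h : Series) → (f *S (g *S h)) ≗ (g *S (f *S h))
*S-leftSwap f g h m = begin
  (f *S (g *S h)) m  ≡⟨ *S-assoc f g h m ⟨
  ((f *S g) *S h) m  ≡⟨ *S-cong {g = h} (*S-comm f g) (λ _ → refl) m ⟩
  ((g *S f) *S h) m  ≡⟨ *S-assoc g f h m ⟩
  (g *S (f *S h)) m  ∎
  where open ≡-Reasoning

*S-identityˡ : ∀ (f : Series) → (oneS *S f) ≗ f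
*S-identityˡ f zero    = ℕP.*-identityˡ (f 0)
*S-identityˡ f (suc m) = begin
  (oneS *S f) (suc m)                       ≡⟨ sumℕ≤-head m _ ⟩
  1 ℕ.* f (suc m) ℕ.+ sumℕ≤ m (λ _ → 0)     ≡⟨ cong₂ ℕ._+_ (ℕP.*-identityˡ _) (sum-0 m) ⟩
  f (suc m) ℕ.+ 0                           ≡⟨ ℕP.+-identityʳ _ ⟩
  f (suc m)                                 ∎
  where
  open ≡-Reasoning
  sum-0 : ∀ m → sumℕ≤ m (λ _ → 0) ≡ 0
  sum-0 zero    = refl
  sum-0 (suc m) = trans (ℕP.+-identityʳ _) (sum-0 m)

*S-identityʳ : ∀ (f : Series) → (f *S oneS) ≗ f
*S-identityʳ f m = trans (*S-comm f oneS m) (*S-identityˡ f m)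

insert : ∀ {r} → (Fin r → Bool) → Fin r → Fin r → Bool
insert T l = updateAt T l (λ _ → true)

-- The factor of `l` moves to the front past the factors before it, by `*S-leftSwap`; inserting `l`
-- deletes it from its old place.
prodNotIn-insert : ∀ {r} (T : Fin r → Bool) (h : Fin r → Series) l → T l ≡ false →
  prodNotIn T h ≗ (h l *S prodNotIn (insert T l) h)
prodNotIn-insert T h zero l∉T m with T zero
... | false = refl
prodNotIn-insert T h (suc l) l∉T m with T zero
... | true  = prodNotIn-insert (T ∘ suc) (h ∘ suc) l l∉T m
... | false = trans (*S-cong {f = h zero} (λ _ → refl) (prodNotIn-insert (T ∘ suc) (h ∘ suc) l l∉T) m)
                    (*S-leftSwap (h zero) (h (suc l)) (prodNotIn (insert (T ∘ suc) l) (h ∘ suc)) m)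

prodNotIn-all : ∀ {r} (T : Fin r → Bool) (h : Fin r → Series) → (∀ k → T k ≡ true) →
  prodNotIn T h ≗ oneS
prodNotIn-all {zero}  T h all m = refl
prodNotIn-all {suc r} T h all m with T zero | all zero
... | true | _ = prodNotIn-all (T ∘ suc) (h ∘ suc) (all ∘ suc) m

-- Cardinalities

module _ {n : ℕ} where

  private variable P Q : Vec ℤ n → Set

  HasCard-≤ : ∀ {a b} → (∀ x → P x → Q x) → HasCard P a → HasCard Q b → a ≤ b
  HasCard-≤ P⊆Q (f , f-inj , f∈P , _) (g , _ , _ , g-onto) =
    FinP.injective⇒≤ {f = λ i → proj₁ (pre i)}
      λ {i} {j} eq → f-inj (trans (sym (proj₂ (pre i))) (trans (cong g eq) (proj₂ (pre j))))
    where
    pre : ∀ i → ∃ λ k → g k ≡ f i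
    pre i = g-onto (f i) (P⊆Q _ (f∈P i))

  HasCard-unique : ∀ {a b} → (∀ x → P x ⇔ Q x) → HasCard P a → HasCard Q b → a ≡ b
  HasCard-unique P⇔Q cP cQ = ℕP.≤-antisym
    (HasCard-≤ (λ x → Equivalence.to (P⇔Q x)) cP cQ)
    (HasCard-≤ (λ x → Equivalence.from (P⇔Q x)) cQ cP)

  HasCard-cong : ∀ {a} → (∀ x → P x ⇔ Q x) → HasCard P a → HasCard Q a
  HasCard-cong P⇔Q (f , f-inj , f∈P , f-onto) =
    f , f-inj , (λ k → Equivalence.to (P⇔Q _) (f∈P k)) , λ x x∈Q → f-onto x (Equivalence.from (P⇔Q x) x∈Q)

  HasCard-⊎ : ∀ {a b} → (∀ x → P x → Q x → ⊥) → HasCard P a → HasCard Q b →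
    HasCard (λ x → P x ⊎ Q x) (a ℕ.+ b)
  HasCard-⊎ {P} {Q} {a} {b} P∩Q (f , f-inj , f∈P , f-onto) (g , g-inj , g∈Q , g-onto) =
    fg ∘ Fin.splitAt a , enum-inj , (λ k → fg∈ (Fin.splitAt a k)) , onto
    where
    fg : Fin a ⊎ Fin b → Vec ℤ n
    fg = [ f , g ]′
    fg-inj : ∀ u v → fg u ≡ fg v → u ≡ v
    fg-inj (inj₁ i) (inj₁ j) eq = cong inj₁ (f-inj eq)
    fg-inj (inj₁ i) (inj₂ j) eq = ⊥-elim (P∩Q _ (f∈P i) (subst Q (sym eq) (g∈Q j)))
    fg-inj (inj₂ i) (inj₁ j) eq = ⊥-elim (P∩Q _ (f∈P j) (subst Q eq (g∈Q i)))
    fg-inj (inj₂ i) (inj₂ j) eq = cong inj₂ (g-inj eq)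
    fg∈ : ∀ u → P (fg u) ⊎ Q (fg u)
    fg∈ (inj₁ i) = inj₁ (f∈P i)
    fg∈ (inj₂ j) = inj₂ (g∈Q j)
    enum-inj : Injective _≡_ _≡_ (fg ∘ Fin.splitAt a)
    enum-inj {i} {j} eq = trans (sym (FinP.join-splitAt a b i))
      (trans (cong (Fin.join a b) (fg-inj (Fin.splitAt a i) (Fin.splitAt a j) eq)) (FinP.join-splitAt a b j))
    onto : ∀ x → P x ⊎ Q x → ∃ λ k → fg (Fin.splitAt a k) ≡ x
    onto x (inj₁ x∈P) = let i , eq = f-onto x x∈P in
      Fin.join a b (inj₁ i) , trans (cong fg (FinP.splitAt-join a b (inj₁ i))) eq
    onto x (inj₂ x∈Q) = let j , eq = g-onto x x∈Q in
      Fin.join a b (inj₂ j) , trans (cong fg (FinP.splitAt-join a b (inj₂ j))) eq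

  -- Injectivity is asked only for arguments in `P` and `Q`: vector addition has it on lattice
  -- points of the two dilates, not on all vectors.
  HasCard-image₂ : ∀ {a b} (_∙_ : Vec ℤ n → Vec ℤ n → Vec ℤ n) →
    (∀ {x y x′ y′} → P x → Q y → P x′ → Q y′ → x ∙ y ≡ x′ ∙ y′ → x ≡ x′ × y ≡ y′) →
    HasCard P a → HasCard Q b →
    HasCard (λ z → ∃₂ λ x y → P x × Q y × x ∙ y ≡ z) (a ℕ.* b)
  HasCard-image₂ {P} {Q} {a} {b} _∙_ ∙-inj (f , f-inj , f∈P , f-onto) (g , g-inj , g∈Q , g-onto) =
    fg ∘ Fin.remQuot {a} b , enum-inj , (λ k → _ , _ , f∈P _ , g∈Q _ , refl) , onto
    where
    fg : Fin a × Fin b → Vec ℤ n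
    fg (i , j) = f i ∙ g j
    enum-inj : Injective _≡_ _≡_ (fg ∘ Fin.remQuot {a} b)
    enum-inj {k} {l} eq with ∙-inj (f∈P _) (g∈Q _) (f∈P _) (g∈Q _) eq
    ... | eqf , eqg = trans (sym (FinP.combine-remQuot {a} b k))
      (trans (cong₂ Fin.combine (f-inj eqf) (g-inj eqg)) (FinP.combine-remQuot {a} b l))
    onto : ∀ z → (∃₂ λ x y → P x × Q y × x ∙ y ≡ z) → ∃ λ k → fg (Fin.remQuot {a} b k) ≡ z
    onto z (x , y , x∈P , y∈Q , eq) =
      let i , fi≡x = f-onto x x∈P
          j , gj≡y = g-onto y y∈Q
      in Fin.combine i j ,
         trans (cong fg (FinP.remQuot-combine {a} i j)) (trans (cong₂ _∙_ fi≡x gj≡y) eq)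

  -- Disjoint classes indexed by `k` have additive counts; with `R k` the sums of points from
  -- dilates `k` and `m ∸ k`, this yields a coefficient of a product series.
  HasCard-sum : ∀ {R : ℕ → Vec ℤ n → Set} {c : Series} m →
    (∀ {j k x} → j ≤ m → k ≤ m → R j x → R k x → j ≡ k) →
    (∀ k → k ≤ m → HasCard (R k) (c k)) →
    HasCard (λ x → ∃ λ k → k ≤ m × R k x) (sumℕ≤ m c)
  HasCard-sum {R} zero R-disj cR = HasCard-cong
    (λ x → mk⇔ (λ x∈R → 0 , z≤n , x∈R) λ { (_ , z≤n , x∈R) → x∈R }) (cR 0 z≤n)
  HasCard-sum {R} (suc m) R-disj cR = HasCard-cong
    (λ x → mk⇔
      (λ { (inj₁ (k , k≤m , x∈R)) → k , ℕP.m≤n⇒m≤1+n k≤m , x∈R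
         ; (inj₂ x∈R)             → suc m , ℕP.≤-refl , x∈R })
      (λ { (k , k≤1+m , x∈R) → [ (λ k<1+m → inj₁ (k , ℕP.≤-pred k<1+m , x∈R))
                               , (λ { refl → inj₂ x∈R }) ]′ (ℕP.m≤n⇒m<n∨m≡n k≤1+m) }))
    (HasCard-⊎
      (λ { x (k , k≤m , x∈Rk) x∈R → ℕP.<⇒≢ (s≤s k≤m) (R-disj (ℕP.m≤n⇒m≤1+n k≤m) ℕP.≤-refl x∈Rk x∈R) })
      (HasCard-sum m (λ j≤m k≤m → R-disj (ℕP.m≤n⇒m≤1+n j≤m) (ℕP.m≤n⇒m≤1+n k≤m))
                     (λ k k≤m → cR k (ℕP.m≤n⇒m≤1+n k≤m)))
      (cR (suc m) ℕP.≤-refl))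

-- Rational sums

sumFin≡sum : ∀ {n} (f : Fin n → ℚ) → sumFin f ≡ sum f
sumFin≡sum {zero}  f = refl
sumFin≡sum {suc n} f = cong (f zero ℚ.+_) (sumFin≡sum (f ∘ suc))

sumFin-cong : ∀ {n} {f g : Fin n → ℚ} → f ≗ g → sumFin f ≡ sumFin g
sumFin-cong {zero}  f≗g = refl
sumFin-cong {suc n} f≗g = cong₂ ℚ._+_ (f≗g zero) (sumFin-cong (f≗g ∘ suc))

sumFin-+ : ∀ {n} (f g : Fin n → ℚ) → sumFin (λ i → f i ℚ.+ g i) ≡ sumFin f ℚ.+ sumFin g
sumFin-+ f g = trans (sumFin≡sum (λ i → f i ℚ.+ g i))
  (trans (∑-distrib-+ f g) (sym (cong₂ ℚ._+_ (sumFin≡sum f) (sumFin≡sum g))))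

sumFin-neg : ∀ {n} (f : Fin n → ℚ) → sumFin (λ i → ℚ.- f i) ≡ ℚ.- sumFin f
sumFin-neg {zero}  f = refl
sumFin-neg {suc n} f = trans (cong (ℚ.- f zero ℚ.+_) (sumFin-neg (f ∘ suc))) (⁻¹-∙-comm (f zero) _)

sumFin-swap : ∀ {m n} (f : Fin m → Fin n → ℚ) →
  sumFin (λ i → sumFin (λ j → f i j)) ≡ sumFin (λ j → sumFin (λ i → f i j))
sumFin-swap f = trans (sumFin²≡sum² f) (trans (∑-comm f) (sym (sumFin²≡sum² (λ j i → f i j))))
  where
  sumFin²≡sum² : ∀ {m n} (f : Fin m → Fin n → ℚ) → sumFin (λ i → sumFin (f i)) ≡ sum (λ i → sum (f i))
  sumFin²≡sum² f = trans (sumFin-cong (λ i → sumFin≡sum (f i))) (sumFin≡sum (λ i → sum (f i)))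

-- Instantiated at the zero subgroup, where it gives uniqueness of a decomposition, and at the
-- integers, where it gives integrality.
record IsSubgroup (P : ℚ → Set) : Set where
  field
    0∈ : P 0ℚ
    +∈ : ∀ {p q} → P p → P q → P (p ℚ.+ q)
    -∈ : ∀ {p q} → P p → P q → P (p ℚ.- q)

  sumFin∈ : ∀ {n} (f : Fin n → ℚ) → (∀ i → P (f i)) → P (sumFin f)
  sumFin∈ {zero}  f f∈ = 0∈
  sumFin∈ {suc n} f f∈ = +∈ (f∈ zero) (sumFin∈ (f ∘ suc) (f∈ ∘ suc))

  summand∈ : ∀ {n} (f : Fin n → ℚ) p → (∀ i → i ≢ p → P (f i)) → P (sumFin f) → P (f p)
  summand∈ f zero    f∈ s∈ =
    subst P (//-rightDividesʳ (sumFin (f ∘ suc)) (f zero))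
      (-∈ s∈ (sumFin∈ (f ∘ suc) λ i → f∈ (suc i) λ ()))
  summand∈ f (suc p) f∈ s∈ = summand∈ (f ∘ suc) p
    (λ i i≢p → f∈ (suc i) (i≢p ∘ FinP.suc-injective))
    (subst P (xyx⁻¹≈y (f zero) (sumFin (f ∘ suc))) (-∈ s∈ (f∈ zero λ ())))

≡0-isSubgroup : IsSubgroup (_≡ 0ℚ)
≡0-isSubgroup = record
  { 0∈ = refl
  ; +∈ = λ p≡0 q≡0 → cong₂ ℚ._+_ p≡0 q≡0
  ; -∈ = λ p≡0 q≡0 → cong₂ ℚ._-_ p≡0 q≡0
  }

abstract

  -- Opaque, so that goals do not unfold into the normalisation of fractions; the lemmas of this
  -- block are its interface.
  ι : ℤ → ℚ
  ι z = z / 1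

  ι≡/1 : ∀ z → ι z ≡ z / 1
  ι≡/1 z = refl

  ι-0 : ι (+ 0) ≡ 0ℚ
  ι-0 = refl

  toℚᵘ-ι : ∀ z → ℚ.toℚᵘ (ι z) ℚᵘ.≃ mkℚᵘ z 0
  toℚᵘ-ι z = ℚP.toℚᵘ-fromℚᵘ (mkℚᵘ z 0)

  ι-injective : ∀ {a b} → ι a ≡ ι b → a ≡ b
  ι-injective {a} {b} eq with ℚP.fromℚᵘ-injective {mkℚᵘ a 0} {mkℚᵘ b 0} eq
  ... | *≡* a*1≡b*1 = trans (sym (ℤP.*-identityʳ a)) (trans a*1≡b*1 (ℤP.*-identityʳ b))

  ι-+ : ∀ a b → ι (a ℤ.+ b) ≡ ι a ℚ.+ ι b
  ι-+ a b = ℚP.toℚᵘ-injective (begin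
    ℚ.toℚᵘ (ι (a ℤ.+ b))             ≈⟨ toℚᵘ-ι (a ℤ.+ b) ⟩
    mkℚᵘ (a ℤ.+ b) 0                 ≈⟨ *≡* (cong (ℤ._* + 1) (sym (cong₂ ℤ._+_ (ℤP.*-identityʳ a) (ℤP.*-identityʳ b)))) ⟩
    mkℚᵘ a 0 ℚᵘ.+ mkℚᵘ b 0           ≈⟨ ℚᵘP.+-cong (toℚᵘ-ι a) (toℚᵘ-ι b) ⟨
    ℚ.toℚᵘ (ι a) ℚᵘ.+ ℚ.toℚᵘ (ι b)   ≈⟨ ℚP.toℚᵘ-homo-+ (ι a) (ι b) ⟨
    ℚ.toℚᵘ (ι a ℚ.+ ι b)             ∎)
    where open import Relation.Binary.Reasoning.Setoid ℚᵘP.≃-setoid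

  ι-nonNeg : ∀ z → 0ℚ ℚ.≤ ι z → ∃ λ k → z ≡ + k
  ι-nonNeg (+ k)      _    = k , refl
  ι-nonNeg (ℤ.-[1+ k ]) 0≤ιz with ℚᵘP.≤-respʳ-≃ (toℚᵘ-ι ℤ.-[1+ k ]) (ℚP.toℚᵘ-mono-≤ 0≤ιz)
  ... | *≤* ()

ι-- : ∀ a b → ι (a ℤ.- b) ≡ ι a ℚ.- ι b
ι-- a b = begin
  ι (a ℤ.- b)                      ≡⟨ //-rightDividesʳ (ι b) (ι (a ℤ.- b)) ⟨
  (ι (a ℤ.- b) ℚ.+ ι b) ℚ.- ι b    ≡⟨ cong (ℚ._- ι b) (ι-+ (a ℤ.- b) b) ⟨
  ι (a ℤ.- b ℤ.+ b) ℚ.- ι b        ≡⟨ cong (λ z → ι z ℚ.- ι b) (ℤG.//-rightDividesˡ b a) ⟩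
  ι a ℚ.- ι b                      ∎
  where open ≡-Reasoning

IsInt : ℚ → Set
IsInt q = ∃ λ z → ι z ≡ q

IsInt-isSubgroup : IsSubgroup IsInt
IsInt-isSubgroup = record
  { 0∈ = + 0 , ι-0
  ; +∈ = λ { (a , refl) (b , refl) → a ℤ.+ b , ι-+ a b }
  ; -∈ = λ { (a , refl) (b , refl) → a ℤ.- b , ι-- a b }
  }

mask : Bool → ℚ → ℚ
mask b q = if b then q else 0ℚ

mask-+ : ∀ b p q → mask b (p ℚ.+ q) ≡ mask b p ℚ.+ mask b q
mask-+ true  p q = refl
mask-+ false p q = refl

mask-neg : ∀ b p → mask b (ℚ.- p) ≡ ℚ.- mask b p
mask-neg true  p = refl
mask-neg false p = refl

mask-sumFin : ∀ {n} b (f : Fin n → ℚ) → mask b (sumFin f) ≡ sumFin (λ i → mask b (f i))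
mask-sumFin {zero}  true  f = refl
mask-sumFin {zero}  false f = refl
mask-sumFin {suc n} b f = trans (mask-+ b (f zero) _) (cong (mask b (f zero) ℚ.+_) (mask-sumFin b (f ∘ suc)))

mask-nonNeg : ∀ b {q} → 0ℚ ℚ.≤ q → 0ℚ ℚ.≤ mask b q
mask-nonNeg true  0≤q = 0≤q
mask-nonNeg false 0≤q = ℚP.≤-refl

mask-not : ∀ b q → mask b q ℚ.+ mask (not b) q ≡ q
mask-not true  q = ℚP.+-identityʳ q
mask-not false q = ℚP.+-identityˡ q

mask≢0 : ∀ b q → mask b q ≢ 0ℚ → b ≡ true × q ≢ 0ℚ
mask≢0 true  q q≢0 = refl , q≢0
mask≢0 false q 0≢0 = ⊥-elim (0≢0 refl)

sumFin-nonNeg : ∀ {n} (f : Fin n → ℚ) → (∀ i → 0ℚ ℚ.≤ f i) → 0ℚ ℚ.≤ sumFin f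
sumFin-nonNeg {zero}  f 0≤f = ℚP.≤-refl
sumFin-nonNeg {suc n} f 0≤f = ℚP.+-mono-≤ (0≤f zero) (sumFin-nonNeg (f ∘ suc) (0≤f ∘ suc))

-- Edge weightings

Weighting : ℕ → Set
Weighting n = Fin n → Fin n → ℚ

module _ {n : ℕ} where

  total : Weighting n → ℚ
  total lam = sumFin (λ i → sumFin (λ j → lam i j))

  degree : Weighting n → Fin n → ℚ
  degree lam v = sumFin (λ u → lam v u ℚ.+ lam u v)

  _⊕_ : Weighting n → Weighting n → Weighting n
  (lam ⊕ mu) i j = lam i j ℚ.+ mu i j

  total-cong : ∀ {lam mu} → (∀ i j → lam i j ≡ mu i j) → total lam ≡ total mu
  total-cong eq = sumFin-cong λ i → sumFin-cong (eq i)

  total-⊕ : ∀ lam mu → total (lam ⊕ mu) ≡ total lam ℚ.+ total mu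
  total-⊕ lam mu = trans (sumFin-cong λ i → sumFin-+ (lam i) (mu i)) (sumFin-+ {n} _ _)

  degree-cong : ∀ {lam mu} → (∀ i j → lam i j ≡ mu i j) → ∀ v → degree lam v ≡ degree mu v
  degree-cong eq v = sumFin-cong λ u → cong₂ ℚ._+_ (eq v u) (eq u v)

  degree-⊕ : ∀ lam mu v → degree (lam ⊕ mu) v ≡ degree lam v ℚ.+ degree mu v
  degree-⊕ lam mu v = trans
    (sumFin-cong λ u → interchange (lam v u) (mu v u) (lam u v) (mu u v))
    (sumFin-+ (λ u → lam v u ℚ.+ lam u v) (λ u → mu v u ℚ.+ mu u v))

  SupportedOn : EdgeSet n → Weighting n → Set
  SupportedOn E lam = ∀ i j → lam i j ≢ 0ℚ → E i j ≡ true

  degree-untouched : ∀ {E lam} → (∀ i j → E i j ≡ E j i) → SupportedOn E lam →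
    ∀ v → ¬ Touches E v → degree lam v ≡ 0ℚ
  degree-untouched {E} {lam} E-sym lam⊆E v v∉E = IsSubgroup.sumFin∈ ≡0-isSubgroup _ λ u →
    cong₂ ℚ._+_ (vanish v u λ vu → v∉E (u , vu)) (vanish u v λ uv → v∉E (u , trans (E-sym v u) uv))
    where
    vanish : ∀ i j → ¬ E i j ≡ true → lam i j ≡ 0ℚ
    vanish i j ij∉E with lam i j ℚ.≟ 0ℚ
    ... | yes eq  = eq
    ... | no  neq = ⊥-elim (ij∉E (lam⊆E i j neq))

  -- Double counting: each pair of nonzero weight has exactly one end in the class `c`, so its
  -- weight is counted once.
  degree-colourClass : ∀ (c : Fin n → Bool) lam → (∀ i j → lam i j ≢ 0ℚ → c i ≢ c j) →
    sumFin (λ v → mask (c v) (degree lam v)) ≡ total lam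
  degree-colourClass c lam proper = begin
    sumFin (λ v → mask (c v) (degree lam v))
      ≡⟨ sumFin-cong (λ v → trans (mask-sumFin {n} (c v) _)
           (trans (sumFin-cong λ u → mask-+ (c v) (lam v u) (lam u v)) (sumFin-+ {n} _ _))) ⟩
    sumFin (λ v → sumFin (λ u → mask (c v) (lam v u)) ℚ.+ sumFin (λ u → mask (c v) (lam u v)))
      ≡⟨ sumFin-+ {n} _ _ ⟩
    total (λ v u → mask (c v) (lam v u)) ℚ.+ total (λ v u → mask (c v) (lam u v))
      ≡⟨ cong (total (λ v u → mask (c v) (lam v u)) ℚ.+_) (sumFin-swap (λ v u → mask (c v) (lam u v))) ⟩
    total (λ v u → mask (c v) (lam v u)) ℚ.+ total (λ v u → mask (c u) (lam v u))
      ≡⟨ total-⊕ _ _ ⟨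
    total (λ v u → mask (c v) (lam v u) ℚ.+ mask (c u) (lam v u))
      ≡⟨ total-cong (λ v u → oneEnd (c v) (c u) (lam v u) (proper v u)) ⟩
    total lam ∎
    where
    open ≡-Reasoning
    oneEnd : ∀ b d q → (q ≢ 0ℚ → b ≢ d) → mask b q ℚ.+ mask d q ≡ q
    oneEnd true  false q _ = ℚP.+-identityʳ q
    oneEnd false true  q _ = ℚP.+-identityˡ q
    oneEnd true  true  q b≢d with q ℚ.≟ 0ℚ
    ... | yes refl = refl
    ... | no  q≢0  = ⊥-elim (b≢d q≢0 refl)
    oneEnd false false q b≢d with q ℚ.≟ 0ℚ
    ... | yes refl = refl
    ... | no  q≢0  = ⊥-elim (b≢d q≢0 refl)

  -- A record, so that unlike with InDilate unification recovers E, m and x.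
  record Dilate (E : EdgeSet n) (m : ℕ) (x : Vec ℤ n) : Set where
    field
      weight    : Weighting n
      nonNeg    : ∀ i j → 0ℚ ℚ.≤ weight i j
      supported : ∀ i j → weight i j ≢ 0ℚ → toℕ i ℕ.< toℕ j × E i j ≡ true
      total≡    : total weight ≡ ι (+ m)
      degree≡   : ∀ v → ι (lookup x v) ≡ degree weight v

    supportedOn : SupportedOn E weight
    supportedOn i j ≢0 = proj₂ (supported i j ≢0)

  InDilate⇔Dilate : ∀ {E m} x → InDilate E m x ⇔ Dilate E m x
  InDilate⇔Dilate {m = m} x = mk⇔
    (λ { (lam , 0≤ , supp , tot , deg) → record
         { weight = lam ; nonNeg = 0≤ ; supported = supp
         ; total≡ = trans tot (sym (ι≡/1 (+ m))) ; degree≡ = λ v → trans (ι≡/1 (lookup x v)) (deg v) } })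
    (λ d → let open Dilate d in
         weight , nonNeg , supported , trans total≡ (ι≡/1 (+ m)) , λ v → trans (sym (ι≡/1 (lookup x v))) (degree≡ v))

  -- The linear equations satisfied by the points of the `M`-th dilate of a bipartite edge polytope.
  -- They are stated for rational functions, to cover differences of points and degrees not yet
  -- known to be integral.
  Balanced : (Fin n → Bool) → ℚ → (Fin n → ℚ) → Set
  Balanced c M y = sumFin (λ v → mask (c v) (y v)) ≡ M × sumFin (λ v → mask (not (c v)) (y v)) ≡ M

  Balanced-- : ∀ {c M N y z} → Balanced c M y → Balanced c N z → Balanced c (M ℚ.- N) (λ v → y v ℚ.- z v)
  Balanced-- {c} {y = y} {z} (yc , yc′) (zc , zc′) = diff c yc zc , diff (not ∘ c) yc′ zc′
    where
    diff : ∀ c {M N} → sumFin (λ v → mask (c v) (y v)) ≡ M → sumFin (λ v → mask (c v) (z v)) ≡ N →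
      sumFin (λ v → mask (c v) (y v ℚ.- z v)) ≡ M ℚ.- N
    diff c refl refl = trans
      (sumFin-cong λ v → trans (mask-+ (c v) (y v) (ℚ.- z v)) (cong (mask (c v) (y v) ℚ.+_) (mask-neg (c v) (z v))))
      (trans (sumFin-+ {n} _ _) (cong (sumFin (λ v → mask (c v) (y v)) ℚ.+_) (sumFin-neg (λ v → mask (c v) (z v)))))

  -- The class avoiding p determines M, and then the class of p determines y p.
  Balanced-closed : ∀ {P} → IsSubgroup P → ∀ {c M y} p → c p ≡ false → Balanced c M y →
    (∀ v → v ≢ p → P (y v)) → P M × P (y p)
  Balanced-closed {P} P-sub {c} {M} {y} p cp (eq , eq′) y∈ = M∈ , yp∈
    where
    open IsSubgroup P-sub
    mask∈ : ∀ b {q} → P q → P (mask b q)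
    mask∈ true  q∈ = q∈
    mask∈ false q∈ = 0∈
    M∈ : P M
    M∈ = subst P eq (sumFin∈ _ λ v → masked v)
      where
      masked : ∀ v → P (mask (c v) (y v))
      masked v with v Fin.≟ p
      ... | yes refl = subst (λ b → P (mask b (y v))) (sym cp) 0∈
      ... | no  v≢p  = mask∈ (c v) (y∈ v v≢p)
    yp∈ : P (y p)
    yp∈ = subst (λ b → P (mask (not b) (y p))) cp
      (summand∈ (λ v → mask (not (c v)) (y v)) p (λ v v≢p → mask∈ (not (c v)) (y∈ v v≢p)) (subst P (sym eq′) M∈))

-- Decidability, parity and lists without repetition

touches? : ∀ {n} (E : EdgeSet n) v → Dec (Touches E v)
touches? E v = FinP.any? λ w → E v w BoolP.≟ true

odd : ℕ → Bool
odd zero    = false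
odd (suc n) = not (odd n)

odd-+ : ∀ m n → odd (m ℕ.+ n) ≡ odd m xor odd n
odd-+ zero    n = refl
odd-+ (suc m) n = trans (cong not (odd-+ m n)) (BoolP.not-distribˡ-xor (odd m) (odd n))

odd⇒%2≡1 : ∀ n → odd n ≡ true → n % 2 ≡ 1
odd⇒%2≡1 (suc zero)    _ = refl
odd⇒%2≡1 (suc (suc n)) p = odd⇒%2≡1 n (trans (sym (BoolP.not-involutive (odd n))) p)

Unique-++⁻ : ∀ {A : Set} (xs : List A) {ys} → Unique (xs ++ ys) → Unique xs × Unique ys
Unique-++⁻ []       ys!         = [] , ys!
Unique-++⁻ (x ∷ xs) (x∉ ∷ xs++ys!) =
  let xs! , ys! = Unique-++⁻ xs xs++ys! in AllP.++⁻ˡ xs x∉ ∷ xs! , ys!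

-- Walks and cycles

module _ {n : ℕ} where

  private variable
    E F : EdgeSet n
    u v w x y : Fin n

  Symmetric : EdgeSet n → Set
  Symmetric E = ∀ i j → E i j ≡ E j i

  Irreflexive : EdgeSet n → Set
  Irreflexive E = ∀ i → E i i ≡ false

  loopless : Irreflexive E → E u v ≡ true → u ≢ v
  loopless {u = u} irr uv refl with () ← trans (sym uv) (irr u)

  infixr 5 _∙_
  _∙_ : Walk E u v → Walk E v w → Walk E u w
  here     ∙ q = q
  step e p ∙ q = step e (p ∙ q)

  reverse : Symmetric E → Walk E u v → Walk E v u
  reverse E-sym here                   = here
  reverse E-sym (step {u} {v} e p) = reverse E-sym p ∙ step (trans (E-sym v u) e) here

  weaken : E ⊆E F → Walk E u v → Walk F u v
  weaken E⊆F here       = here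
  weaken E⊆F (step e p) = step (E⊆F _ _ e) (weaken E⊆F p)

  -- The final vertex is left out, so that a closed walk lists its base point once and `Unique` can
  -- hold for it.
  starts : Walk E u v → List (Fin n)
  starts here           = []
  starts (step {u} e p) = u ∷ starts p

  len : Walk E u v → ℕ
  len p = length (starts p)

  starts-∙ : (p : Walk E u v) (q : Walk E v w) → starts (p ∙ q) ≡ starts p ++ starts q
  starts-∙ here       q = refl
  starts-∙ (step e p) q = cong (_ ∷_) (starts-∙ p q)

  len-∙ : (p : Walk E u v) (q : Walk E v w) → len (p ∙ q) ≡ len p ℕ.+ len q
  len-∙ p q = trans (cong length (starts-∙ p q)) (ListP.length-++ (starts p))

  len-reverse : (E-sym : Symmetric E) (p : Walk E u v) → len (reverse E-sym p) ≡ len p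
  len-reverse E-sym here       = refl
  len-reverse E-sym (step e p) = trans (len-∙ (reverse E-sym p) _)
    (trans (ℕP.+-comm _ 1) (cong suc (len-reverse E-sym p)))

  starts-weaken : (E⊆F : E ⊆E F) (p : Walk E u v) → starts (weaken E⊆F p) ≡ starts p
  starts-weaken E⊆F here       = refl
  starts-weaken E⊆F (step e p) = cong (_ ∷_) (starts-weaken E⊆F p)

  starts-touch : (p : Walk E u v) → All (Touches E) (starts p)
  starts-touch here       = []
  starts-touch (step e p) = (_ , e) ∷ starts-touch p

  data Traverses (a b : Fin n) {E : EdgeSet n} : ∀ {u v} → Walk E u v → Set where
    first : ∀ {v} {e : E a b ≡ true} {p : Walk E b v} → Traverses a b (step e p)
    later : ∀ {u v w} {e : E u v ≡ true} {p : Walk E v w} → Traverses a b p → Traverses a b (step e p)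

  Traverses-∙ʳ : ∀ {a b} (p : Walk E u v) {q : Walk E v w} → Traverses a b q → Traverses a b (p ∙ q)
  Traverses-∙ʳ here       t = t
  Traverses-∙ʳ (step e p) t = later (Traverses-∙ʳ p t)

  -- Positions past the end default to the final vertex, which is also the value at position
  -- `len p`.
  at : Walk E u v → ℕ → Fin n
  at {u = u} here       _       = u
  at {u = u} (step e p) zero    = u
  at         (step e p) (suc i) = at p i

  at-zero : (p : Walk E u v) → at p 0 ≡ u
  at-zero here       = refl
  at-zero (step e p) = refl

  at-len : (p : Walk E u v) → at p (len p) ≡ v
  at-len here       = refl
  at-len (step e p) = at-len p

  at-edge : (p : Walk E u v) → ∀ i → i ℕ.< len p → E (at p i) (at p (suc i)) ≡ true
  at-edge {E = E} (step {u} e p) zero    _       = trans (cong (E u) (at-zero p)) e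
  at-edge         (step e p)     (suc i) (s≤s i<) = at-edge p i i<

  at-All : ∀ {P : Fin n → Set} (p : Walk E u v) → All P (starts p) → ∀ i → i ℕ.< len p → P (at p i)
  at-All (step e p) (Pu ∷ _)  zero    _        = Pu
  at-All (step e p) (_ ∷ all) (suc i) (s≤s i<) = at-All p all i i<

  at-injective : (p : Walk E u v) → Unique (starts p) → ∀ i j → i ℕ.< len p → j ℕ.< len p →
    at p i ≡ at p j → i ≡ j
  at-injective (step e p) _         zero    zero    _        _        _  = refl
  at-injective (step e p) (u∉ ∷ _)  zero    (suc j) _        (s≤s j<) eq = ⊥-elim (at-All p u∉ j j< eq)
  at-injective (step e p) (u∉ ∷ _)  (suc i) zero    (s≤s i<) _        eq = ⊥-elim (at-All p u∉ i i< (sym eq))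
  at-injective (step e p) (_ ∷ p!)  (suc i) (suc j) (s≤s i<) (s≤s j<) eq = cong suc (at-injective p p! i j i< j< eq)

  at-traversed : ∀ {a b} (p : Walk E u v) → Traverses a b p →
    ∃ λ i → i ℕ.< len p × at p i ≡ a × at p (suc i) ≡ b
  at-traversed (step e p) first     = 0 , s≤s z≤n , refl , at-zero p
  at-traversed (step e p) (later t) =
    let i , i< , eq , eq′ = at-traversed p t in suc i , s≤s i< , eq , eq′

  toℕ-next : ∀ {m} (t : Fin (suc m)) →
    toℕ (next t) ≡ suc (toℕ t) ⊎ (next t ≡ zero × toℕ t ≡ m)
  toℕ-next {m} t with toℕ t ℕP.<? m
  ... | yes t<m = inj₁ (FinP.toℕ-fromℕ< (s≤s t<m))
  ... | no  t≮m = inj₂ (refl , ℕP.≤-antisym (ℕP.≤-pred (FinP.toℕ<n t)) (ℕP.≮⇒≥ t≮m))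

  next-inject₁ : ∀ {m} (t : Fin m) → next (inject₁ t) ≡ suc t
  next-inject₁ t with toℕ-next (inject₁ t)
  ... | inj₁ eq       = FinP.toℕ-injective (trans eq (cong suc (FinP.toℕ-inject₁ t)))
  ... | inj₂ (_ , eq) = ⊥-elim (ℕP.<⇒≢ (FinP.toℕ<n t) (trans (sym (FinP.toℕ-inject₁ t)) eq))

  closedWalk⇒Cycle : (p : Walk E u u) → Unique (starts p) → 3 ≤ len p →
    Σ (Cycle E) λ C → cycleLength C ≡ len p × (∀ {a b} → Traverses a b p → OnCycle C a b)
  closedWalk⇒Cycle {E} {u} p p! 3≤p = C , 3+k≡p , onCycle
    where
    k = len p ∸ 3
    3+k≡p : 3 ℕ.+ k ≡ len p
    3+k≡p = ℕP.m+[n∸m]≡n 3≤p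
    bound : (t : Fin (3 ℕ.+ k)) → toℕ t ℕ.< len p
    bound t = subst (toℕ t ℕ.<_) 3+k≡p (FinP.toℕ<n t)
    at-next : ∀ t → at p (toℕ (next {2 ℕ.+ k} t)) ≡ at p (suc (toℕ t))
    at-next t with toℕ-next t
    ... | inj₁ eq            = cong (at p) eq
    -- At the last index `next` wraps round to position 0, while the successor is position `len p`;
    -- the walk is closed, so both carry the vertex `u`.
    ... | inj₂ (eq , t≡last) = trans (cong (at p ∘ toℕ) eq) (trans (at-zero p)
      (sym (trans (cong (at p) (trans (cong suc t≡last) 3+k≡p)) (at-len p))))
    C : Cycle E
    C = record
      { len₋₃ = k
      ; vert  = λ t → at p (toℕ t)
      ; inj   = λ {s} {t} eq → FinP.toℕ-injective (at-injective p p! _ _ (bound s) (bound t) eq)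
      ; edges = λ t → subst (λ z → E (at p (toℕ t)) z ≡ true) (sym (at-next t)) (at-edge p (toℕ t) (bound t))
      }
    onCycle : ∀ {a b} → Traverses a b p → OnCycle C a b
    onCycle tr with at-traversed p tr
    ... | i , i< , eq , eq′ = t , inj₁ (trans (cong (at p) toℕt) eq , trans (at-next t) (trans (cong (at p ∘ suc) toℕt) eq′))
      where
      i<′ = subst (i ℕ.<_) (sym 3+k≡p) i<
      t : Fin (3 ℕ.+ k)
      t = fromℕ< i<′
      toℕt : toℕ t ≡ i
      toℕt = FinP.toℕ-fromℕ< i<′

  Cycle-walk : (C : Cycle E) → (∀ t → F (vert C t) (vert C (next t)) ≡ true) →
    ∀ t → Walk F (vert C zero) (vert C t)
  Cycle-walk {F = F} C inF = <-weakInduction (λ t → Walk F (vert C zero) (vert C t)) here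
    λ t p → p ∙ step (subst (λ s → F (vert C (inject₁ t)) (vert C s) ≡ true) (next-inject₁ t) (inF (inject₁ t))) here

  -- Stronger than `Unique (starts p)`: the end may not recur either, so a simple closed walk has no
  -- edges.
  Simple : Walk E u v → Set
  Simple {v = v} p = Unique (starts p) × All (v ≢_) (starts p)

  -- The cut is at the first visit to `x`, so the initial piece does not pass through `x` before its
  -- end.
  splitAtVertex : ∀ x (p : Walk E u v) →
    (All (x ≢_) (starts p) × x ≢ v)
    ⊎ (∃₂ λ (q : Walk E u x) (r : Walk E x v) → p ≡ q ∙ r × All (x ≢_) (starts q))
  splitAtVertex {u = u} x here with x Fin.≟ u
  ... | yes refl = inj₂ (here , here , refl , [])
  ... | no  x≢u  = inj₁ ([] , x≢u)
  splitAtVertex x (step {u} e p) with x Fin.≟ u | splitAtVertex x p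
  ... | yes refl | _                          = inj₂ (here , step e p , refl , [])
  ... | no x≢u   | inj₁ (x∉p , x≢v)           = inj₁ (x≢u ∷ x∉p , x≢v)
  ... | no x≢u   | inj₂ (q , r , refl , x∉q)  = inj₂ (step e q , r , refl , x≢u ∷ x∉q)

  Simple-suffix : (q : Walk E u x) {r : Walk E x v} → Simple (q ∙ r) → Unique (starts q) × Simple r
  Simple-suffix {E = E} {v = v} q {r} (qr! , v∉qr) =
    let eq      = starts-∙ q r
        q! , r! = Unique-++⁻ (starts q) (subst Unique eq qr!)
    in q! , r! , AllP.++⁻ʳ (starts q) (subst (All (v ≢_)) eq v∉qr)

  -- Length one would be a loop, and lengths zero and two are even, so the walk is long enough to be
  -- a cycle.
  oddCycle : Irreflexive E → (p : Walk E u u) → Unique (starts p) → odd (len p) ≡ true → HasOddCycle E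
  oddCycle {E = E} irr (step e here) p! _ = ⊥-elim (loopless {E = E} irr e refl)
  oddCycle irr p@(step _ (step _ (step _ _))) p! p-odd =
    let C , eq , _ = closedWalk⇒Cycle p p! (s≤s (s≤s (s≤s z≤n)))
    in C , trans (cong (_% 2) eq) (odd⇒%2≡1 (len p) p-odd)

  -- Each erased loop is a cycle, so without odd cycles loop erasure preserves parity.
  record LoopErasure (p : Walk E u v) : Set₁ where
    field
      path   : Walk E u v
      simple : Simple path
      subset : ∀ {P : Fin n → Set} → All P (starts p) → All P (starts path)
      parity : HasOddCycle E ⊎ odd (len p) ≡ odd (len path)

  loopErasure : Irreflexive E → (p : Walk E u v) → LoopErasure p
  loopErasure irr here = record { path = here ; simple = [] , [] ; subset = λ all → all ; parity = inj₂ refl }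
  loopErasure {E = E} irr (step {u} e p) with loopErasure irr p
  ... | record { path = p′ ; simple = p′-simple ; subset = p′⊆p ; parity = par } with splitAtVertex u p′
  ... | inj₁ (u∉p′ , u≢v) = record
    { path   = step e p′
    ; simple = u∉p′ ∷ proj₁ p′-simple , (u≢v ∘ sym) ∷ proj₂ p′-simple
    ; subset = λ { (Pu ∷ all) → Pu ∷ p′⊆p all }
    ; parity = [ inj₁ , inj₂ ∘ cong not ]′ par
    }
  ... | inj₂ (q , r , refl , u∉q) = record
    { path   = r
    ; simple = proj₂ (Simple-suffix q p′-simple)
    ; subset = λ { {P} (_ ∷ all) → AllP.++⁻ʳ (starts q) (subst (All P) (starts-∙ q r) (p′⊆p all)) }
    ; parity = [ inj₁ , loopParity ]′ par
    }
    where
    loopParity : odd (len p) ≡ odd (len (q ∙ r)) → HasOddCycle E ⊎ not (odd (len p)) ≡ odd (len r)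
    -- The erased loop is `step e q`, one edge longer than `q`: it is an odd cycle if `q` is even,
    -- and otherwise its removal keeps the parity.
    loopParity eq with odd (len q) in q-odd
    ... | false = inj₁ (oddCycle irr (step e q) (u∉q ∷ proj₁ (Simple-suffix q p′-simple)) (cong not q-odd))
    ... | true  = inj₂ (trans (cong not (trans eq (trans (cong odd (len-∙ q r))
      (trans (odd-+ (len q) (len r)) (cong (_xor odd (len r)) q-odd))))) (BoolP.not-involutive _))

  -- Loop erasure reduces a closed walk to the empty one, and changes parity only if it meets an odd
  -- cycle.
  closedWalk-even : Irreflexive E → ¬ HasOddCycle E → (p : Walk E u u) → odd (len p) ≡ false
  closedWalk-even irr noOdd p with loopErasure irr p
  ... | record { parity = inj₁ oddC } = ⊥-elim (noOdd oddC)
  ... | record { path = here ; parity = inj₂ eq } = eq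
  ... | record { path = step _ _ ; simple = _ , u≢u ∷ _ } = ⊥-elim (u≢u refl)

  -- Colour a vertex by the parity of a chosen walk from a base vertex. An edge with equally
  -- coloured ends would close the two chosen walks to an odd closed walk.
  bipartite : Symmetric E → Irreflexive E → ConnectedE E → ¬ HasOddCycle E →
    ∃ λ (c : Fin n → Bool) → ∀ i j → E i j ≡ true → c i ≢ c j
  bipartite {E} E-sym irr conn noOdd with FinP.any? (touches? E)
  ... | no  empty   = (λ _ → false) , λ i j ij → ⊥-elim (empty (i , j , ij))
  ... | yes (a , a∈E) = c , proper
    where
    distanceParity : ∀ v → Dec (Touches E v) → Bool
    distanceParity v (yes v∈E) = odd (len (conn a v a∈E v∈E))
    -- An arbitrary colour: no edge ends at such a vertex.
    distanceParity v (no _)    = false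
    c : Fin n → Bool
    c v = distanceParity v (touches? E v)
    c-walk : ∀ v → Touches E v → Σ (Walk E a v) λ p → c v ≡ odd (len p)
    c-walk v v∈E with touches? E v
    ... | yes v∈E′ = conn a v a∈E v∈E′ , refl
    ... | no  v∉E  = ⊥-elim (v∉E v∈E)
    proper : ∀ i j → E i j ≡ true → c i ≢ c j
    proper i j ij ci≡cj with c-walk i (j , ij) | c-walk j (i , trans (E-sym j i) ij)
    ... | p , ci≡ | q , cj≡ = BoolP.not-¬ refl (trans (sym even) odd≡)
      where
      open ≡-Reasoning
      closed = p ∙ step ij (reverse E-sym q)
      even : odd (len closed) ≡ false
      even = closedWalk-even irr noOdd closed
      odd≡ : odd (len closed) ≡ not false
      odd≡ = begin
        odd (len closed)                  ≡⟨ cong odd (len-∙ p _) ⟩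
        odd (len p ℕ.+ suc (len (reverse E-sym q))) ≡⟨ odd-+ (len p) _ ⟩
        odd (len p) xor not (odd (len (reverse E-sym q)))
          ≡⟨ cong (λ l → odd (len p) xor not (odd l)) (len-reverse E-sym q) ⟩
        odd (len p) xor not (odd (len q)) ≡⟨ cong₂ (λ b d → b xor not d) (sym ci≡) (trans (sym cj≡) (sym ci≡cj)) ⟩
        c i xor not (c i)                 ≡⟨ BoolP.not-distribʳ-xor (c i) (c i) ⟨
        not (c i xor c i)                 ≡⟨ cong not (BoolP.xor-same (c i)) ⟩
        not false                         ∎

  -- An excursion from `K` that returns at a different vertex and avoids `K` in between. The trail
  -- may repeat vertices, and it is empty when `exit` already leads to `b`.
  record Ear (E : EdgeSet n) (K : Fin n → Set) : Set where
    field
      {a b s} : Fin n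
      a∈K   : K a
      b∈K   : K b
      a≢b   : a ≢ b
      exit  : E a s ≡ true
      trail : Walk E s b
      clean : All (¬_ ∘ K) (starts trail)

  -- Here `b` is the first vertex of the walk in `K`. Working back from the end, `b` stays equal to
  -- `v` until some vertex of `K` differs from the first hit after it, and there an ear opens.
  firstHit : ∀ {K : Fin n → Set} → Decidable K → (p : Walk E u v) → K v →
    ∃ λ b → Σ (Walk E u b) λ q → K b × All (¬_ ∘ K) (starts q) × (K u → u ≡ b) × (b ≡ v ⊎ Ear E K)
  firstHit K? here v∈K = _ , here , v∈K , [] , (λ _ → refl) , inj₁ refl
  firstHit K? (step {u} e p) v∈K with firstHit K? p v∈K | K? u
  ... | b , q , b∈K , q-clean , _ , end | no u∉K =
    b , step e q , b∈K , u∉K ∷ q-clean , (λ u∈K → ⊥-elim (u∉K u∈K)) , end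
  ... | b , q , b∈K , q-clean , _ , end | yes u∈K with u Fin.≟ b
  ... | yes refl = u , here , u∈K , [] , (λ _ → refl) , end
  ... | no  u≢b  = u , here , u∈K , [] , (λ _ → refl) ,
    inj₂ record { a∈K = u∈K ; b∈K = b∈K ; a≢b = u≢b ; exit = e ; trail = q ; clean = q-clean }

  ear : ∀ {K : Fin n → Set} → Decidable K → Walk E u v → K u → K v → u ≢ v → Ear E K
  ear K? p u∈K v∈K u≢v with firstHit K? p v∈K
  ... | b , _ , _ , _ , u≡b , inj₁ refl = ⊥-elim (u≢v (u≡b u∈K))
  ... | b , _ , _ , _ , _   , inj₂ E-ear = E-ear

  MixedCycle : (A E F : EdgeSet n) → Set
  MixedCycle A E F = Σ (Cycle A) λ C →
    (∃₂ λ a b → E a b ≡ true × OnCycle C a b) × (∃₂ λ c d → F c d ≡ true × OnCycle C c d)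

  -- Close an ear of the vertex set of F by a simple path in F.
  mixedCycle : ∀ {A} → Irreflexive A → E ⊆E A → F ⊆E A → Symmetric F → ConnectedE F →
    (∀ i j → E i j ≡ true → F i j ≡ true → ⊥) →
    Walk E u v → Touches F u → Touches F v → u ≢ v → MixedCycle A E F
  mixedCycle {E} {F} {A = A} irr E⊆A F⊆A F-sym F-conn disj p u∈F v∈F u≢v
    with ear (touches? F) p u∈F v∈F u≢v
  ... | record { a = a ; b = b ; s = y ; a∈K = a∈F ; b∈K = b∈F ; a≢b = a≢b
             ; exit = e ; trail = q ; clean = q-clean }
    = close (LoopErasure.path q′) (LoopErasure.simple q′) (LoopErasure.subset q′ q-clean)
            (LoopErasure.path r′) (LoopErasure.simple r′)
    where
    irr-⊆ : ∀ {H} → H ⊆E A → Irreflexive H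
    irr-⊆ {H} H⊆A i with H i i in ii
    ... | false = refl
    ... | true with () ← trans (sym (H⊆A i i ii)) (irr i)
    q′ = loopErasure (irr-⊆ E⊆A) q
    r′ = loopErasure (irr-⊆ F⊆A) (F-conn b a b∈F a∈F)

    close : (q : Walk E y b) → Simple q → All (¬_ ∘ Touches F) (starts q) →
            (r : Walk F b a) → Simple r → MixedCycle A E F
    close q q-simple q-clean here r-simple = ⊥-elim (a≢b refl)
    close q (q! , _) q-clean r@(step {v = z} f r₁) (r! , a∉r) =
      let C , _ , onC = closedWalk⇒Cycle closed closed! (long q r₁ e f)
      in C , (a , y , e , onC first) , (b , z , f , onC (later (Traverses-∙ʳ (weaken E⊆A q) first)))
      where
      q⁺ = weaken E⊆A q
      r⁺ = weaken F⊆A r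
      closed : Walk A a a
      closed = step (E⊆A _ _ e) (q⁺ ∙ r⁺)
      starts-closed : starts (q⁺ ∙ r⁺) ≡ starts q ++ starts r
      starts-closed = trans (starts-∙ q⁺ r⁺) (cong₂ _++_ (starts-weaken E⊆A q) (starts-weaken F⊆A r))
      closed! : Unique (starts closed)
      closed! = subst (Unique ∘ (a ∷_)) (sym starts-closed)
        -- The vertices of `q` before `b` lie off `F`, while `a` and the vertices of `r` lie on it,
        -- so the pieces share none.
        (AllP.++⁺ (All.map (λ x∉F a≡x → x∉F (subst (Touches F) a≡x a∈F)) q-clean) a∉r
         ∷ AllPairsP.++⁺ q! r! (All.map (λ x∉F → All.map
            (λ z∈F x≡z → x∉F (subst (Touches F) (sym x≡z) z∈F)) (starts-touch r)) q-clean))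
      long : ∀ {y} (q : Walk E y b) (r₁ : Walk F z a) (e : E a y ≡ true) (f : F b z ≡ true) →
        3 ≤ len (step (E⊆A _ _ e) (weaken E⊆A q ∙ weaken F⊆A (step f r₁)))
      -- A closed walk of length two would use the edge between `a` and `b` in both `E` and `F`.
      long here       here       e f = ⊥-elim (disj a b e (trans (F-sym a b) f))
      long here       (step _ _) e f = s≤s (s≤s (s≤s z≤n))
      long (step _ q) r₁         e f = s≤s (s≤s (subst (1 ≤_) (sym (len-∙ (weaken E⊆A q) _))
        (ℕP.≤-trans (s≤s z≤n) (ℕP.m≤n+m _ (len (weaken E⊆A q))))))

-- Lattice points of dilates, and gluing at one vertex

lookup-ext : ∀ {n} {x y : Vec ℤ n} → (∀ v → lookup x v ≡ lookup y v) → x ≡ y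
lookup-ext {x = x} {y} eq =
  trans (sym (VecP.tabulate∘lookup x)) (trans (VecP.tabulate-cong eq) (VecP.tabulate∘lookup y))

_+ᵥ_ : ∀ {n} → Vec ℤ n → Vec ℤ n → Vec ℤ n
_+ᵥ_ = zipWith ℤ._+_

ι-lookup-+ᵥ : ∀ {n} (x y : Vec ℤ n) v → ι (lookup (x +ᵥ y) v) ≡ ι (lookup x v) ℚ.+ ι (lookup y v)
ι-lookup-+ᵥ x y v = trans (cong ι (VecP.lookup-zipWith ℤ._+_ v x y)) (ι-+ (lookup x v) (lookup y v))

Dilate-off : ∀ {n} {E : EdgeSet n} {m x} → (∀ i j → E i j ≡ E j i) → Dilate E m x →
  ∀ v → ¬ Touches E v → ι (lookup x v) ≡ 0ℚ
Dilate-off {E = E} E-sym d v v∉E =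
  trans (degree≡ v) (degree-untouched {E = E} E-sym supportedOn v v∉E)
  where open Dilate d

Dilate-balanced : ∀ {n} {E : EdgeSet n} {m x} {c : Fin n → Bool} →
  (∀ i j → E i j ≡ true → c i ≢ c j) → Dilate E m x → Balanced c (ι (+ m)) (λ v → ι (lookup x v))
Dilate-balanced {E = E} {m} {x} {c} proper d =
  classSum c proper , classSum (not ∘ c) (λ i j ij → proper i j ij ∘ BoolP.not-injective)
  where
  open Dilate d
  classSum : ∀ c → (∀ i j → E i j ≡ true → c i ≢ c j) → sumFin (λ v → mask (c v) (ι (lookup x v))) ≡ ι (+ m)
  classSum c proper = trans (sumFin-cong λ v → cong (mask (c v)) (degree≡ v))
    (trans (degree-colourClass c weight λ i j ≢0 → proper i j (supportedOn i j ≢0)) total≡)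

Dilate-+ : ∀ {n} {E E₁ E₂ : EdgeSet n} → E₁ ⊆E E → E₂ ⊆E E → ∀ {k l x y} →
  Dilate E₁ k x → Dilate E₂ l y → Dilate E (k ℕ.+ l) (x +ᵥ y)
Dilate-+ {E = E} E₁⊆E E₂⊆E {k} {l} {x} {y} d₁ d₂ = record
  { weight    = lam ⊕ mu
  ; nonNeg    = λ i j → ℚP.+-mono-≤ (D₁.nonNeg i j) (D₂.nonNeg i j)
  ; supported = supp
  ; total≡    = trans (total-⊕ lam mu) (trans (cong₂ ℚ._+_ D₁.total≡ D₂.total≡) (sym (ι-+ (+ k) (+ l))))
  ; degree≡   = λ v → trans (ι-lookup-+ᵥ x y v)
      (trans (cong₂ ℚ._+_ (D₁.degree≡ v) (D₂.degree≡ v)) (sym (degree-⊕ lam mu v)))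
  }
  where
  module D₁ = Dilate d₁
  module D₂ = Dilate d₂
  lam = D₁.weight
  mu  = D₂.weight
  supp : ∀ i j → lam i j ℚ.+ mu i j ≢ 0ℚ → toℕ i ℕ.< toℕ j × E i j ≡ true
  supp i j sum≢0 with lam i j ℚ.≟ 0ℚ | mu i j ℚ.≟ 0ℚ
  ... | no lam≢0  | _        = let i<j , ij∈E₁ = D₁.supported i j lam≢0 in i<j , E₁⊆E i j ij∈E₁
  ... | yes _     | no mu≢0  = let i<j , ij∈E₂ = D₂.supported i j mu≢0 in i<j , E₂⊆E i j ij∈E₂
  ... | yes lam≡0 | yes mu≡0 = ⊥-elim (sum≢0 (cong₂ ℚ._+_ lam≡0 mu≡0))

-- Only `E₂` has to be bipartite. The class `c` is the one avoiding `p`, and `shared` also allows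
-- the two edge sets to have no common vertex, as when `E₁` is empty.
module Gluing {n} {E E₁ E₂ : EdgeSet n}
  (E₁-sym : ∀ i j → E₁ i j ≡ E₁ j i) (E₂-sym : ∀ i j → E₂ i j ≡ E₂ j i)
  (E₁⊆E : E₁ ⊆E E) (E₂⊆E : E₂ ⊆E E) (E⊆E₁∪E₂ : ∀ i j → E i j ≡ true → E₁ i j ≡ true ⊎ E₂ i j ≡ true)
  (c : Fin n → Bool) (proper : ∀ i j → E₂ i j ≡ true → c i ≢ c j)
  (p : Fin n) (cp : c p ≡ false) (shared : ∀ v → Touches E₁ v → Touches E₂ v → v ≡ p)
  where

  offPoint : ∀ v → v ≢ p → ¬ Touches E₁ v ⊎ ¬ Touches E₂ v
  offPoint v v≢p with touches? E₁ v
  ... | no  v∉E₁ = inj₁ v∉E₁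
  ... | yes v∈E₁ = inj₂ λ v∈E₂ → v≢p (shared v v∈E₁ v∈E₂)

  -- The difference of `y` and `y′` is balanced with sum `l` minus `l′` and vanishes off `p`, where
  -- one summand of each decomposition is zero. `Balanced-closed` for the zero subgroup finishes.
  decomposition-unique : ∀ {k l k′ l′ x y x′ y′} →
    Dilate E₁ k x → Dilate E₂ l y → Dilate E₁ k′ x′ → Dilate E₂ l′ y′ →
    x +ᵥ y ≡ x′ +ᵥ y′ → l ≡ l′ × x ≡ x′ × y ≡ y′
  decomposition-unique {l = l} {l′ = l′} {x} {y} {x′} {y′} x∈ y∈ x′∈ y′∈ eq =
    ℤP.+-injective (ι-injective (x∙y⁻¹≈ε⇒x≈y _ _ (proj₁ closed))) ,
    lookup-ext (λ v → ℤG.∙-cancelʳ (lookup y v) _ _ (trans (lookup-eq v) (cong (λ z → lookup x′ v ℤ.+ z) (sym (y≡y′ v))))) ,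
    lookup-ext y≡y′
    where
    lookup-eq : ∀ v → lookup x v ℤ.+ lookup y v ≡ lookup x′ v ℤ.+ lookup y′ v
    lookup-eq v = trans (sym (VecP.lookup-zipWith ℤ._+_ v x y))
      (trans (cong (λ z → lookup z v) eq) (VecP.lookup-zipWith ℤ._+_ v x′ y′))
    off : ∀ v → v ≢ p → lookup y v ≡ lookup y′ v
    off v v≢p with offPoint v v≢p
    ... | inj₂ v∉E₂ = ι-injective (trans (Dilate-off E₂-sym y∈ v v∉E₂) (sym (Dilate-off E₂-sym y′∈ v v∉E₂)))
    ... | inj₁ v∉E₁ = ℤG.∙-cancelˡ (lookup x v) _ _
      (trans (lookup-eq v) (cong (ℤ._+ lookup y′ v)
        (ι-injective (trans (Dilate-off E₁-sym x′∈ v v∉E₁) (sym (Dilate-off E₁-sym x∈ v v∉E₁))))))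
    closed = Balanced-closed ≡0-isSubgroup {c = c} {y = λ v → ι (lookup y v) ℚ.- ι (lookup y′ v)} p cp
      (Balanced-- {c = c} (Dilate-balanced proper y∈) (Dilate-balanced proper y′∈))
      (λ v v≢p → x≈y⇒x∙y⁻¹≈ε (cong ι (off v v≢p)))
    y≡y′ : ∀ v → lookup y v ≡ lookup y′ v
    y≡y′ v with v Fin.≟ p
    ... | yes refl = ι-injective (x∙y⁻¹≈ε⇒x≈y _ _ (proj₂ closed))
    ... | no  v≢p  = off v v≢p

  -- Split a weighting of `z` into its part on `E₁` and the rest, which lives on `E₂`. The degrees
  -- of the rest are integers off `p`, hence everywhere, and so is its total.
  decompose : ∀ {m z} → Dilate E m z →
    ∃ λ k → k ≤ m × ∃₂ λ x y → Dilate E₁ k x × Dilate E₂ (m ∸ k) y × x +ᵥ y ≡ z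
  decompose {m} {z} d = k , k≤m , x , y ,
    record { weight = lam₁ ; nonNeg = λ i j → mask-nonNeg (E₁ i j) (0≤lam i j)
           ; supported = supp₁ ; total≡ = tot₁ ; degree≡ = deg₁ } ,
    record { weight = lam₂ ; nonNeg = λ i j → mask-nonNeg (not (E₁ i j)) (0≤lam i j)
           ; supported = supp₂ ; total≡ = tot₂ ; degree≡ = deg₂ } ,
    lookup-ext λ v → trans (VecP.lookup-zipWith ℤ._+_ v x y)
      (trans (cong (ℤ._+ lookup y v) (VecP.lookup∘tabulate _ v)) (ℤG.//-rightDividesˡ (lookup y v) (lookup z v)))
    where
    open Dilate d renaming (weight to lam; supported to supp; total≡ to tot; degree≡ to deg; nonNeg to 0≤lam)
    lam₁ lam₂ : Weighting n
    lam₁ i j = mask (E₁ i j) (lam i j)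
    lam₂ i j = mask (not (E₁ i j)) (lam i j)
    split : ∀ i j → lam₁ i j ℚ.+ lam₂ i j ≡ lam i j
    split i j = mask-not (E₁ i j) (lam i j)
    supp₁ : ∀ i j → lam₁ i j ≢ 0ℚ → toℕ i ℕ.< toℕ j × E₁ i j ≡ true
    supp₁ i j ≢0 = let ij∈E₁ , lam≢0 = mask≢0 (E₁ i j) _ ≢0 in proj₁ (supp i j lam≢0) , ij∈E₁
    supp₂ : ∀ i j → lam₂ i j ≢ 0ℚ → toℕ i ℕ.< toℕ j × E₂ i j ≡ true
    supp₂ i j ≢0 with mask≢0 (not (E₁ i j)) _ ≢0
    ... | ij∉E₁ , lam≢0 with supp i j lam≢0
    ... | i<j , ij∈E with E⊆E₁∪E₂ i j ij∈E
    ... | inj₂ ij∈E₂ = i<j , ij∈E₂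
    ... | inj₁ ij∈E₁ with () ← trans (sym (cong not ij∈E₁)) ij∉E₁

    degrees : ∀ v → degree lam₁ v ℚ.+ degree lam₂ v ≡ ι (lookup z v)
    degrees v = trans (sym (degree-⊕ lam₁ lam₂ v)) (trans (degree-cong split v) (sym (deg v)))
    totals : total lam₁ ℚ.+ total lam₂ ≡ ι (+ m)
    totals = trans (sym (total-⊕ lam₁ lam₂)) (trans (total-cong split) tot)
    balanced : Balanced c (total lam₂) (degree lam₂)
    balanced =
      degree-colourClass c lam₂ (λ i j ≢0 → proper i j (proj₂ (supp₂ i j ≢0))) ,
      degree-colourClass (not ∘ c) lam₂ (λ i j ≢0 → proper i j (proj₂ (supp₂ i j ≢0)) ∘ BoolP.not-injective)
    off : ∀ v → v ≢ p → IsInt (degree lam₂ v)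
    off v v≢p with offPoint v v≢p
    -- Here the whole coordinate of `z` comes from `lam₂`.
    ... | inj₁ v∉E₁ = lookup z v , trans (sym (degrees v))
      (trans (cong (ℚ._+ degree lam₂ v) (degree-untouched {E = E₁} E₁-sym (λ i j ≢0 → proj₂ (supp₁ i j ≢0)) v v∉E₁))
             (ℚP.+-identityˡ _))
    ... | inj₂ v∉E₂ = + 0 , trans ι-0 (sym (degree-untouched {E = E₂} E₂-sym (λ i j ≢0 → proj₂ (supp₂ i j ≢0)) v v∉E₂))
    closed : IsInt (total lam₂) × IsInt (degree lam₂ p)
    closed = Balanced-closed IsInt-isSubgroup p cp balanced off
    integral : ∀ v → IsInt (degree lam₂ v)
    integral v with v Fin.≟ p
    ... | yes refl = proj₂ closed
    ... | no  v≢p  = off v v≢p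

    complement : ∀ {a b : ℚ} {s t} → a ℚ.+ b ≡ ι s → ι t ≡ b → ι (s ℤ.- t) ≡ a
    complement {a} {b} {s} {t} a+b≡s t≡b = trans (ι-- s t)
      (trans (cong₂ ℚ._-_ (sym a+b≡s) t≡b) (//-rightDividesʳ b a))

    total₁ : IsInt (total lam₁)
    total₁ = + m ℤ.- proj₁ (proj₁ closed) , complement totals (proj₂ (proj₁ closed))
    natural : ∀ {mu} → (∀ i j → 0ℚ ℚ.≤ mu i j) → IsInt (total {n} mu) → ∃ λ k → ι (+ k) ≡ total mu
    natural {mu} 0≤mu (a , ιa≡) with ι-nonNeg a (subst (0ℚ ℚ.≤_) (sym ιa≡) (sumFin-nonNeg _ λ i → sumFin-nonNeg _ (0≤mu i)))
    ... | k , refl = k , ιa≡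
    nat₁ = natural {lam₁} (λ i j → mask-nonNeg (E₁ i j) (0≤lam i j)) total₁
    nat₂ = natural {lam₂} (λ i j → mask-nonNeg (not (E₁ i j)) (0≤lam i j)) (proj₁ closed)
    k l : ℕ
    k = proj₁ nat₁
    l = proj₁ nat₂
    k+l≡m : k ℕ.+ l ≡ m
    k+l≡m = ℤP.+-injective (ι-injective (trans (ι-+ (+ k) (+ l)) (trans (cong₂ ℚ._+_ (proj₂ nat₁) (proj₂ nat₂)) totals)))
    k≤m : k ≤ m
    k≤m = subst (k ≤_) k+l≡m (ℕP.m≤m+n k l)
    tot₁ : total lam₁ ≡ ι (+ k)
    tot₁ = sym (proj₂ nat₁)
    tot₂ : total lam₂ ≡ ι (+ (m ∸ k))
    tot₂ = trans (sym (proj₂ nat₂)) (cong (λ j → ι (+ j)) (trans (sym (ℕP.m+n∸m≡n k l)) (cong (_∸ k) k+l≡m)))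
    x y : Vec ℤ n
    y = tabulate λ v → proj₁ (integral v)
    -- Integral by construction; `complement` identifies it with the degrees of `lam₁`.
    x = tabulate λ v → lookup z v ℤ.- lookup y v
    deg₂ : ∀ v → ι (lookup y v) ≡ degree lam₂ v
    deg₂ v = trans (cong ι (VecP.lookup∘tabulate _ v)) (proj₂ (integral v))
    deg₁ : ∀ v → ι (lookup x v) ≡ degree lam₁ v
    deg₁ v = trans (cong ι (VecP.lookup∘tabulate _ v)) (complement (degrees v) (deg₂ v))

  -- The lattice points of the `m`-th dilate are classified by the dilation factor `k` of their `E₁`
  -- part; each class is in bijection with pairs of points.
  IsEhrhart-glue : ∀ {h₁ h₂} → IsEhrhart E₁ h₁ → IsEhrhart E₂ h₂ → IsEhrhart E (h₁ *S h₂)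
  IsEhrhart-glue {h₁} {h₂} eh₁ eh₂ m = HasCard-cong
    (λ z → mk⇔
      (λ { (k , k≤m , x , y , x∈ , y∈ , refl) → Equivalence.from (InDilate⇔Dilate _)
             (subst (λ j → Dilate E j (x +ᵥ y)) (ℕP.m+[n∸m]≡n k≤m) (Dilate-+ E₁⊆E E₂⊆E x∈ y∈)) })
      (decompose ∘ Equivalence.to (InDilate⇔Dilate z)))
    (HasCard-sum m
      (λ { j≤m k≤m (x , y , x∈ , y∈ , eq) (x′ , y′ , x′∈ , y′∈ , eq′) →
           -- Uniqueness compares the `E₂` factors `m ∸ j` and `m ∸ k`; as subtraction truncates,
           -- both bounds are needed to recover the indices.
           ℕP.∸-cancelˡ-≡ j≤m k≤m (proj₁ (decomposition-unique x∈ y∈ x′∈ y′∈ (trans eq (sym eq′)))) })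
      (λ k k≤m → HasCard-image₂ _+ᵥ_
        (λ x∈ y∈ x′∈ y′∈ eq → proj₂ (decomposition-unique x∈ y∈ x′∈ y′∈ eq))
        (HasCard-cong InDilate⇔Dilate (eh₁ k)) (HasCard-cong InDilate⇔Dilate (eh₂ (m ∸ k)))))

-- Unions of selected blocks

unionE⁻ : ∀ {n r} (B : Fin r → EdgeSet n) T i j → unionE B T i j ≡ true →
  ∃ λ k → T k ≡ true × B k i j ≡ true
unionE⁻ {r = suc r} B T i j ij with T zero in T0 | B zero i j in B0
... | true  | true  = zero , T0 , B0
... | true  | false = let k , Tk , Bk = unionE⁻ (B ∘ suc) (T ∘ suc) i j ij in suc k , Tk , Bk
... | false | _     = let k , Tk , Bk = unionE⁻ (B ∘ suc) (T ∘ suc) i j ij in suc k , Tk , Bk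

unionE⁺ : ∀ {n r} (B : Fin r → EdgeSet n) T k i j → T k ≡ true → B k i j ≡ true → unionE B T i j ≡ true
unionE⁺ B T zero    i j Tk Bk rewrite Tk | Bk = refl
unionE⁺ B T (suc k) i j Tk Bk =
  trans (cong ((T zero ∧ B zero i j) ∨_) (unionE⁺ (B ∘ suc) (T ∘ suc) k i j Tk Bk)) (BoolP.∨-zeroʳ _)

insert-true : ∀ {r} (T : Fin r → Bool) l → insert T l l ≡ true
insert-true T l = updateAt-updates l T

insert-⊇ : ∀ {r} (T : Fin r → Bool) l k → T k ≡ true → insert T l k ≡ true
insert-⊇ T l k Tk with k Fin.≟ l
... | yes refl = insert-true T l
... | no  k≢l  = trans (updateAt-minimal k l T k≢l) Tk

insert⁻ : ∀ {r} (T : Fin r → Bool) l k → insert T l k ≡ true → k ≡ l ⊎ T k ≡ true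
insert⁻ T l k ins with k Fin.≟ l
... | yes k≡l = inj₁ k≡l
... | no  k≢l = inj₂ (trans (sym (updateAt-minimal k l T k≢l)) ins)

-- The recursion measure of `factorisation`.
missing : ∀ {r} → (Fin r → Bool) → ℕ
missing {zero}  T = 0
missing {suc r} T with T zero
... | true  = missing (T ∘ suc)
... | false = suc (missing (T ∘ suc))

missing-insert : ∀ {r} (T : Fin r → Bool) l → T l ≡ false → missing T ≡ suc (missing (insert T l))
missing-insert T zero l∉T with T zero
... | false = refl
missing-insert T (suc l) l∉T with T zero
... | true  = missing-insert (T ∘ suc) l l∉T
... | false = cong suc (missing-insert (T ∘ suc) l l∉T)

InDilate-mono : ∀ {n} {E F : EdgeSet n} → E ⊆E F → ∀ m x → InDilate E m x → InDilate F m x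
InDilate-mono E⊆F m x (lam , 0≤ , supp , rest) =
  lam , 0≤ , (λ i j ≢0 → let i<j , ij = supp i j ≢0 in i<j , E⊆F i j ij) , rest

-- Swapping the two colours keeps a colouring proper, so the attaching vertex can be put in the
-- class that `Gluing` expects.
recolour : ∀ {n} {E : EdgeSet n} p → (∃ λ (c : Fin n → Bool) → ∀ i j → E i j ≡ true → c i ≢ c j) →
  ∃ λ (c : Fin n → Bool) → (∀ i j → E i j ≡ true → c i ≢ c j) × c p ≡ false
recolour p (c , proper) with c p in cp
... | false = c , proper , cp
... | true  = not ∘ c , (λ i j ij → proper i j ij ∘ BoolP.not-injective) , cong not cp

-- Blocks

module Blocks {n} (G : SimpleGraph n) {r} (B : Fin r → EdgeSet n) (blocks : BlockList G r B) where

  open BlockList blocks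
  private module Block k = IsBlock (isBlock k)

  false≢true : ∀ {b : Bool} → b ≡ false → b ≡ true → ⊥
  false≢true refl ()

  onCycle-adj : (C : Cycle (adj G)) → ∀ {a b} → OnCycle C a b → adj G a b ≡ true
  onCycle-adj C (t , inj₁ (refl , refl)) = edges C t
  onCycle-adj C (t , inj₂ (refl , refl)) = trans (symm G _ _) (edges C t)

  onCycle-vertex : (C : Cycle (adj G)) → ∀ {a b} → OnCycle C a b → ∃ λ t → vert C t ≡ a
  onCycle-vertex C (t , inj₁ (eq , _)) = t , eq
  onCycle-vertex C (t , inj₂ (_ , eq)) = next t , eq

  cycle-inBlock : ∀ k (C : Cycle (adj G)) {a b c d} → OnCycle C a b → B k a b ≡ true →
    OnCycle C c d → B k c d ≡ true
  cycle-inBlock k C {a} {b} {c} {d} onab ab oncd =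
    proj₂ (Block.closed k a b c d ab (onCycle-adj C oncd)) (inj₂ (C , onab , oncd))

  -- Two edges of a block coincide or lie on a common cycle, and all edges of that cycle belong to
  -- the block, so one can walk along it.
  block-connected : ∀ k → ConnectedE (B k)
  block-connected k u v (x , ux) (y , vy)
    with proj₁ (Block.closed k u x v y ux (Block.sub k v y vy)) vy
  ... | inj₁ (inj₁ (refl , _)) = here
  ... | inj₁ (inj₂ (_ , refl)) = step ux here
  ... | inj₂ (C , onux , onvy) =
    let s , s≡u = onCycle-vertex C onux
        t , t≡v = onCycle-vertex C onvy
    in subst₂ (Walk (B k)) s≡u t≡v (reverse (Block.symmB k) (walk s) ∙ walk t)
    where
    walk : ∀ t → Walk (B k) (vert C zero) (vert C t)
    walk = Cycle-walk C λ t → cycle-inBlock k C onux ux (t , inj₁ (refl , refl))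

  block-irreflexive : ∀ k → Irreflexive (B k)
  block-irreflexive k i with B k i i in ii
  ... | false = refl
  ... | true  = ⊥-elim (false≢true (irrefl G i) (Block.sub k i i ii))

  block-sub-union : ∀ (T : Fin r → Bool) k → T k ≡ true → B k ⊆E unionE B T
  block-sub-union T k Tk i j = unionE⁺ B T k i j Tk

  union-sub : ∀ T → unionE B T ⊆E adj G
  union-sub T i j ij = let k , _ , Bk = unionE⁻ B T i j ij in Block.sub k i j Bk

  union-sub-insert : ∀ T l → unionE B T ⊆E unionE B (insert T l)
  union-sub-insert T l i j ij =
    let k , Tk , Bk = unionE⁻ B T i j ij in unionE⁺ B (insert T l) k i j (insert-⊇ T l k Tk) Bk

  union-insert⁻ : ∀ T l i j → unionE B (insert T l) i j ≡ true → unionE B T i j ≡ true ⊎ B l i j ≡ true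
  union-insert⁻ T l i j ij with unionE⁻ B (insert T l) i j ij
  ... | k , ins , Bk with insert⁻ T l k ins
  ... | inj₁ refl = inj₂ Bk
  ... | inj₂ Tk   = inj₁ (unionE⁺ B T k i j Tk Bk)

  union-symmetric : ∀ T → Symmetric (unionE B T)
  union-symmetric T i j = sym-∨ B T (λ k → Block.symmB k i j)
    where
    sym-∨ : ∀ {r} (B : Fin r → EdgeSet n) T → (∀ k → B k i j ≡ B k j i) → unionE B T i j ≡ unionE B T j i
    sym-∨ {zero}  B T eq = refl
    sym-∨ {suc r} B T eq = cong₂ _∨_ (cong (T zero ∧_) (eq zero)) (sym-∨ (B ∘ suc) (T ∘ suc) (eq ∘ suc))

  block-disjoint : ∀ (T : Fin r → Bool) l → T l ≡ false → ∀ k → T k ≡ true →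
    ∀ i j → B k i j ≡ true → B l i j ≡ true → ⊥
  block-disjoint T l l∉T k k∈T i j ijk ijl =
    false≢true (disjoint k l (λ { refl → false≢true l∉T k∈T }) i j ijk) ijl

  -- Two common vertices give a cycle with an edge in block `l` and an edge in some block `k` of
  -- `T`. The whole cycle then lies in block `k`, against disjointness.
  meet-unique : ∀ T l → T l ≡ false → ConnectedE (unionE B T) → ∀ u v →
    Touches (unionE B T) u → Touches (unionE B T) v → Touches (B l) u → Touches (B l) v → u ≡ v
  meet-unique T l l∉T T-conn u v uT vT ul vl with u Fin.≟ v
  ... | yes u≡v = u≡v
  ... | no  u≢v with mixedCycle (irrefl G) (union-sub T) (Block.sub l) (Block.symmB l) (block-connected l)
        (λ i j ijT → let k , k∈T , ijk = unionE⁻ B T i j ijT in block-disjoint T l l∉T k k∈T i j ijk)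
        (T-conn u v uT vT) ul vl u≢v
  ... | C , (a , b , ab , onab) , (c , d , cd , oncd) =
    let k , k∈T , abk = unionE⁻ B T a b ab
    in ⊥-elim (block-disjoint T l l∉T k k∈T c d (cycle-inBlock k C onab abk oncd) cd)

  -- Attaching the blocks one at a time

  record Attachment (T : Fin r → Bool) : Set where
    field
      {block}    : Fin r
      block∉T    : T block ≡ false
      {point}    : Fin n
      inBlock    : Touches (B block) point
      -- The second case is an empty union, the starting point when `G` has no odd cycle; any vertex
      -- of the block then serves as `point`.
      inUnion    : Touches (unionE B T) point ⊎ (∀ v → ¬ Touches (unionE B T) v)

  -- Follow the walk until an edge belongs to a block outside `T`; that block is attached at the
  -- current vertex. If this never happens, `v` itself lies on the union and block `k` is attached
  -- there.
  firstExit : ∀ T {u v k} → Walk (adj G) u v → Touches (unionE B T) u → T k ≡ false → Touches (B k) v →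
    Attachment T
  firstExit T here uT k∉T vk = record { block∉T = k∉T ; inBlock = vk ; inUnion = inj₁ uT }
  firstExit T (step {u} {w} uw p) uT k∉T vk with covers u w uw
  ... | l , uwl with T l in Tl
  ... | false = record { block∉T = Tl ; inBlock = w , uwl ; inUnion = inj₁ uT }
  ... | true  = firstExit T p (u , unionE⁺ B T l w u Tl (trans (Block.symmB l w u) uwl)) k∉T vk

  attachment : Connected G → ∀ T k → T k ≡ false → Attachment T
  attachment G-conn T k k∉T with Block.nonempty k | FinP.any? (touches? (unionE B T))
  ... | a , b , ab | yes (u , uT) = firstExit T (G-conn u a) uT k∉T (b , ab)
  ... | a , b , ab | no  empty    = record
    { block∉T = k∉T ; inBlock = b , ab ; inUnion = inj₂ λ v vT → empty (v , vT) }

  insert-connected : ∀ T → ConnectedE (unionE B T) → (att : Attachment T) →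
    ConnectedE (unionE B (insert T (Attachment.block att)))
  insert-connected T T-conn att u v u∈ v∈ = toPoint u u∈ ∙ reverse (union-symmetric (insert T block)) (toPoint v v∈)
    where
    open Attachment att
    toPoint : ∀ v → Touches (unionE B (insert T block)) v → Walk (unionE B (insert T block)) v point
    toPoint v (w , vw) with union-insert⁻ T block v w vw | inUnion
    ... | inj₂ vw∈l | _           = weaken (block-sub-union (insert T block) block (insert-true T block))
                                           (block-connected block v point (w , vw∈l) inBlock)
    ... | inj₁ vw∈T | inj₁ p∈T    = weaken (union-sub-insert T block) (T-conn v point (w , vw∈T) p∈T)
    ... | inj₁ vw∈T | inj₂ empty  = ⊥-elim (empty v (w , vw∈T))

  meet-point : ∀ T → ConnectedE (unionE B T) → (att : Attachment T) → ∀ v →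
    Touches (unionE B T) v → Touches (B (Attachment.block att)) v → v ≡ Attachment.point att
  meet-point T T-conn att v vT vl with Attachment.inUnion att
  ... | inj₁ pT    = meet-unique T _ (Attachment.block∉T att) T-conn v _ vT pT vl (Attachment.inBlock att)
  ... | inj₂ empty = ⊥-elim (empty v vT)

  -- Admissibility puts every block with an odd cycle into `T`, so the new block is bipartite and
  -- gluing applies.
  IsEhrhart-insert : ∀ T → Admissible B T → (att : Attachment T) → let l = Attachment.block att in
    ∀ {h hl} → IsEhrhart (unionE B T) h → IsEhrhart (B l) hl → IsEhrhart (unionE B (insert T l)) (h *S hl)
  IsEhrhart-insert T (T-odd , T-conn) att = Gluing.IsEhrhart-glue
    (union-symmetric T) (Block.symmB block)
    (union-sub-insert T block) (block-sub-union (insert T block) block (insert-true T block)) (union-insert⁻ T block)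
    (proj₁ colouring) (proj₁ (proj₂ colouring)) point (proj₂ (proj₂ colouring))
    (meet-point T T-conn att)
    where
    open Attachment att
    colouring = recolour {E = B block} point
      (bipartite (Block.symmB block) (block-irreflexive block) (block-connected block)
        (λ oddC → false≢true block∉T (T-odd block oddC)))

  module _ (G-conn : Connected G) {hG : Series} {hB : Fin r → Series}
           (ehG : IsEhrhart (adj G) hG) (ehB : ∀ k → IsEhrhart (B k) (hB k)) where

    -- Stated for every admissible `T` and every Ehrhart series `h` of its union, so that attaching
    -- a block moves its factor from the product into `h`. With no block missing, the union has
    -- exactly the edges of `G` and the product is `oneS`.
    factorisation : ∀ d T → missing T ≡ d → Admissible B T → ∀ h → IsEhrhart (unionE B T) h →
      hG ≗ (h *S prodNotIn T hB)
    factorisation d T T-missing T-adm h ehT m with FinP.any? (λ k → T k BoolP.≟ false)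
    ... | no all = begin
      hG m                      ≡⟨ HasCard-unique (λ x → mk⇔ (InDilate-mono adj⊆T m x) (InDilate-mono (union-sub T) m x)) (ehG m) (ehT m) ⟩
      h m                       ≡⟨ *S-identityʳ h m ⟨
      (h *S oneS) m             ≡⟨ *S-cong {f = h} (λ _ → refl) (prodNotIn-all T hB T-all) m ⟨
      (h *S prodNotIn T hB) m   ∎
      where
      open ≡-Reasoning
      T-all : ∀ k → T k ≡ true
      T-all k = BoolP.¬-not (λ k∉T → all (k , k∉T))
      adj⊆T : adj G ⊆E unionE B T
      adj⊆T i j ij = let k , ijk = covers i j ij in unionE⁺ B T k i j (T-all k) ijk
    factorisation zero T T-missing T-adm h ehT m | yes (k , k∉T)
      with () ← trans (sym T-missing) (missing-insert T k k∉T)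
    factorisation (suc d) T T-missing T-adm@(T-odd , T-conn) h ehT m | yes (k , k∉T) = begin
      hG m                                                ≡⟨ factorisation d (insert T l) missing-d adm (h *S hB l)
                                                               (IsEhrhart-insert T T-adm att ehT (ehB l)) m ⟩
      ((h *S hB l) *S prodNotIn (insert T l) hB) m        ≡⟨ *S-assoc h (hB l) (prodNotIn (insert T l) hB) m ⟩
      (h *S (hB l *S prodNotIn (insert T l) hB)) m        ≡⟨ *S-cong {f = h} (λ _ → refl) (prodNotIn-insert T hB l block∉T) m ⟨
      (h *S prodNotIn T hB) m                             ∎
      where
      open ≡-Reasoning
      att = attachment G-conn T k k∉T
      open Attachment att renaming (block to l)
      missing-d : missing (insert T l) ≡ d
      missing-d = ℕP.suc-injective (trans (sym (missing-insert T l block∉T)) T-missing)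
      adm : Admissible B (insert T l)
      adm = (λ k oddC → insert-⊇ T l k (T-odd k oddC)) , insert-connected T T-conn att

theorem3p3 : ∀ {n} (G : SimpleGraph n) → Connected G →
    (r : ℕ) (B : Fin r → EdgeSet n) → BlockList G r B →
    (S : Fin r → Bool) → IsOddmentCore B S →
    (hG h₀ : Series) (hB : Fin r → Series) →
    IsEhrhart (adj G) hG → IsEhrhart (unionE B S) h₀ → (∀ k → IsEhrhart (B k) (hB k)) →
    ∀ m → hG m ≡ (h₀ *S prodNotIn S hB) m
theorem3p3 G G-conn r B blocks S (S-adm , _) hG h₀ hB ehG eh₀ ehB =
  Blocks.factorisation G B blocks G-conn ehG ehB (missing S) S refl S-adm h₀ eh₀
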